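{- For any integer $t\geq 2$, $$r'_2(K_{2,t})\leq CR(K_{2,t},K_3)\leq \left\lfloor\frac{4t}{3}\right\rfloor+2.$$ For any integers $t\geq s\geq 3$, $$r'_2(K_{s,t})\leq CR(K_{s,t},K_3)\leq \left\lceil \frac{2^s}{s+1}(t-1)+\frac{(s-1)(s+6)}{6}\right\rceil+1.$$
   Context: An edge-colored graph $G$ on $p$ vertices with edge-coloring $\chi$ is called orderable if there exist an ordering $(v_1,\ldots,v_p)$ of $V(G)$ and a list $(c_1,\ldots,c_{p-1})$ of not necessarily distinct colors such that for every edge $v_iv_j\in E(G)$ with $i<j$ we have $\chi(v_iv_j)=c_i$. An edge-colored graph is rainbow if all its edges have pairwise different colors. For a graph $G$, $r'_2(G)$ is the minimum integer $n$ such that every 2-edge-coloring of $K_n$ (each edge gets one of two given colors) contains an orderable copy of $G$. For graphs $G,H$, $CR(G,H)$ is the minimum integer $n$ such that every edge-coloring of $K_n$ with any number of colors contains either an orderable copy of $G$ or a rainbow copy of $H$. Copies are (not necessarily induced) subgraphs with the inherited coloring. -}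

module Defs where

open import Data.Empty using (⊥)
open import Data.Fin.Base using (Fin; toℕ; splitAt) renaming (_<_ to _<ᶠ_)
open import Data.Fin.Permutation using (Permutation′; _⟨$⟩ʳ_)
open import Data.Fin.Properties using (_≟_)
open import Data.Nat.Base using (ℕ; _+_; _∸_; _≤_)
open import Data.Product.Base using (_×_; Σ-syntax)
open import Data.Sum.Base using (_⊎_; inj₁; inj₂)
open import Data.Unit.Base using (⊤; tt)
open import Data.Vec.Base using (Vec; lookup)
open import Function.Base using (_on_)
open import Function.Definitions using (Injective)
open import Level using (0ℓ)
open import Relation.Binary.Core using (Rel)
open import Relation.Binary.Definitions using (Decidable; Symmetric)
open import Relation.Binary.PropositionalEquality
  using (_≡_; _≢_; refl; ≢-sym)
open import Relation.Nullary.Decidable using (yes; no; ¬?)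
open import Relation.Nullary.Negation using (¬_)

record Graph : Set₁ where
  field
    order  : ℕ
    Adj    : Rel (Fin order) 0ℓ
    adj?   : Decidable Adj
    sym    : Symmetric Adj
    irrefl : ∀ v → ¬ Adj v v

  Vertex : Set
  Vertex = Fin order

open Graph using (Vertex)

complete : ℕ → Graph
complete n = record
  { order  = n
  ; Adj    = _≢_
  ; adj?   = λ u v → ¬? (u ≟ v)
  ; sym    = ≢-sym
  ; irrefl = λ _ v≢v → v≢v refl
  }

module _ {s t : ℕ} where

  Across : Rel (Fin s ⊎ Fin t) 0ℓ
  Across (inj₁ _) (inj₁ _) = ⊥
  Across (inj₁ _) (inj₂ _) = ⊤
  Across (inj₂ _) (inj₁ _) = ⊤
  Across (inj₂ _) (inj₂ _) = ⊥

  across? : Decidable Across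
  across? (inj₁ _) (inj₁ _) = no λ ()
  across? (inj₁ _) (inj₂ _) = yes tt
  across? (inj₂ _) (inj₁ _) = yes tt
  across? (inj₂ _) (inj₂ _) = no λ ()

  across-sym : Symmetric Across
  across-sym {inj₁ _} {inj₂ _} _ = tt
  across-sym {inj₂ _} {inj₁ _} _ = tt

  across-irrefl : ∀ x → ¬ Across x x
  across-irrefl (inj₁ _) ()
  across-irrefl (inj₂ _) ()

completeBipartite : ℕ → ℕ → Graph
completeBipartite s t = record
  { order  = s + t
  ; Adj    = Across on splitAt s
  ; adj?   = λ u v → across? (splitAt s u) (splitAt s v)
  ; sym    = λ {u} {v} → across-sym {x = splitAt s u} {y = splitAt s v}
  ; irrefl = λ v → across-irrefl (splitAt s v)
  }

-- Colors are also assigned to non-adjacent pairs (including the diagonal);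
-- those values are never inspected by the notions below.
record EdgeColoring (G : Graph) (C : Set) : Set where
  field
    color : Vertex G → Vertex G → C
    sym   : ∀ u v → color u v ≡ color v u

-- A not necessarily induced copy of G in H.
record Copy (G H : Graph) : Set where
  field
    embed     : Vertex G → Vertex H
    injective : Injective _≡_ _≡_ embed
    adj       : ∀ {u v} → Graph.Adj G u v → Graph.Adj H (embed u) (embed v)

inherited : ∀ {G H C} → Copy G H → EdgeColoring H C → EdgeColoring G C
inherited f χ = record
  { color = λ u v → color (embed u) (embed v)
  ; sym   = λ u v → sym (embed u) (embed v)
  }
  where
  open Copy f
  open EdgeColoring χ

-- The list of colors has length p - 1, so the position i of the earlier
-- endpoint, an element of Fin p, is matched with an index k of the list by
-- value; such a k exists whenever i < j.
Orderable : (G : Graph) {C : Set} → EdgeColoring G C → Set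
Orderable G {C} χ =
  Σ[ v ∈ Permutation′ order ] Σ[ c ∈ Vec C (order ∸ 1) ]
    ∀ (i j : Fin order) (k : Fin (order ∸ 1)) → toℕ k ≡ toℕ i → i <ᶠ j →
    Adj (v ⟨$⟩ʳ i) (v ⟨$⟩ʳ j) →
    color (v ⟨$⟩ʳ i) (v ⟨$⟩ʳ j) ≡ lookup c k
  where
  open Graph G using (order; Adj)
  open EdgeColoring χ using (color)

Rainbow : (G : Graph) {C : Set} → EdgeColoring G C → Set
Rainbow G χ =
  ∀ {u v x y} → Adj u v → Adj x y →
  ¬ ((u ≡ x × v ≡ y) ⊎ (u ≡ y × v ≡ x)) →
  color u v ≢ color x y
  where
  open Graph G using (Adj)
  open EdgeColoring χ using (color)

HasOrderableCopy : (G : Graph) {H : Graph} {C : Set} → EdgeColoring H C → Set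
HasOrderableCopy G {H} χ = Σ[ f ∈ Copy G H ] Orderable G (inherited f χ)

HasRainbowCopy : (G : Graph) {H : Graph} {C : Set} → EdgeColoring H C → Set
HasRainbowCopy G {H} χ = Σ[ f ∈ Copy G H ] Rainbow G (inherited f χ)

IsMinimum : (ℕ → Set) → ℕ → Set
IsMinimum P n = P n × (∀ m → P m → n ≤ m)

-- IsR′₂ G n says that r′₂(G) is defined and equal to n.
IsR′₂ : Graph → ℕ → Set
IsR′₂ G = IsMinimum λ n →
  (χ : EdgeColoring (complete n) (Fin 2)) → HasOrderableCopy G χ

-- IsCR G H n says that CR(G, H) is defined and equal to n.  As complete n is
-- finite, palettes Fin q with q arbitrary account for all edge-colorings.
IsCR : Graph → Graph → ℕ → Set
IsCR G H = IsMinimum λ n →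
  ∀ q (χ : EdgeColoring (complete n) (Fin q)) →
  HasOrderableCopy G χ ⊎ HasRainbowCopy H χ

{-# OPTIONS --safe #-}

-- Consider a coloring of K_n without rainbow triangle, where
-- n ≥ 2^s/(s+1) (t-1) + s(s+5)/6, strictly if s ≤ 2.
--
-- If every vertex sees at most two colors, choose the s-side A at random
-- together with a random one of the two colors at each of its vertices.  A
-- vertex v can be put into the ordering exactly if it agrees with the chosen
-- colors on an initial segment of A and sees the rest of A in one color.  If
-- the final monochromatic run of v in A has length l, this has probability
-- 2^(l-s), and by convexity the expected number of such v exceeds t-1.
--
-- If some vertex sees three colors, then one of these is not connected, and
-- its components are modules: every outside vertex sees them in one color.  A
-- proper module with at least s vertices contains an orderable copy by
-- induction, where all outside vertices can join the t-side.  A smaller module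
-- that is maximal sees only two colors; it becomes part of the s-side, and a
-- smaller complete bipartite graph is found in its larger color neighborhood.
--
-- The minima exist because the defining properties can be decided by a finite
-- search.
module Submission where

open import Defs
open import Data.Nat.Base using (ℕ; suc; _+_; _*_; _^_; _∸_; _≤_; _/_)
open import Data.Product.Base using (_×_; ∃₂)

open import Data.Bool.Base using (Bool; true; false; _∧_; _∨_; not; if_then_else_)
open import Data.Bool.ListAction using (all)
import Data.Bool.Properties as Bool
open import Data.Empty using (⊥)
open import Data.Fin.Base using (Fin; zero; suc; toℕ; cast; inject₁; join; splitAt; combine; remQuot)
  renaming (_<_ to _<ᶠ_)
open import Data.Fin.Permutation
  using (Permutation′; permutation; _⟨$⟩ʳ_; _⟨$⟩ˡ_; inverseˡ; inverseʳ)
import Data.Fin.Properties as Fin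
open import Data.Integer.Base as ℤ using (ℤ; -[1+_])
import Data.Integer.DivMod as ℤ
import Data.Integer.Properties as ℤ
open import Data.List.Base
  using (List; []; _∷_; _++_; map; filter; length; take; drop; lookup)
open import Data.List.Membership.Propositional using (_∈_; _∉_; find; lose)
open import Data.List.Membership.Propositional.Properties
  using (∈-filter⁻; ∈-filter⁺; ∈-++⁺ʳ; ∈-++⁻; ∈-lookup)
open import Data.List.Properties
  using (filter-all; length-take; length-++; length-filter; length-tabulate;
         take++drop≡id; ++-assoc; ++-identityʳ)
open import Data.List.Relation.Binary.Disjoint.Propositional using (Disjoint)
open import Data.List.Relation.Binary.Permutation.Propositional
  using (_↭_; ↭-refl; ↭-trans; ↭-sym; prep; ↭⇒↭ₛ)
open import Data.List.Relation.Binary.Permutation.Propositional.Properties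
  using (shift; ↭-length; ++⁺ˡ; All-resp-↭; ∈-resp-↭)
import Data.List.Relation.Binary.Permutation.Setoid.Properties as Permutation
open import Data.List.Relation.Unary.All as All using (All; []; _∷_)
import Data.List.Relation.Unary.All.Properties as All
open import Data.List.Relation.Unary.AllPairs as AllPairs using ([]; _∷_)
open import Data.List.Relation.Unary.Any as Any using (here; there)
open import Data.List.Relation.Unary.Unique.Propositional using (Unique)
import Data.List.Relation.Unary.Unique.Propositional.Properties as Unique
open import Data.Nat.Base using (zero; _<_; _%_; z≤n; s≤s; s≤s⁻¹)
open import Data.Nat.DivMod using (m≡m%n+[m/n]*n; m%n<n)
open import Data.Nat.ListAction using (sum)
open import Data.Nat.Properties as ℕ hiding (_≟_)
open import Data.Nat.Tactic.RingSolver using (solve-∀)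
open import Data.Product using (_,_; proj₁; proj₂; ∃; ∃-syntax; map₂)
open import Data.Rational.Unnormalised.Base as ℚᵘ using (ℚᵘ; mkℚᵘ; ceiling)
open import Data.Sum as Sum using (_⊎_; inj₁; inj₂; [_,_]′)
import Data.Vec.Functional as Vector
open import Data.Vec.Base as Vec using (tabulate)
open import Data.Vec.Properties using (lookup∘tabulate; lookup-map)
open import Function.Base using (_∘_; id)
open import Relation.Binary.Definitions using (DecidableEquality)
open import Relation.Binary.PropositionalEquality
open import Relation.Nullary
open import Relation.Nullary.Decidable
  using (_×-dec_; _⊎-dec_; _→-dec_; decidable-stable; map′; from-yes)
open import Relation.Unary using (Decidable)

-- The constant s(s+5)/6 is s + s(s-1)/6. The summand s accounts for the vertices of A themselves.
-- The rest pays for drawing A without repetition: with repetition, convexity alone would bound the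
-- chance of a monochromatic run; with distinct vertices, a run of j+1 vertices loses at most the
-- fraction j(j+1)/(2(n-s)). Summed over j < s these losses give (s-1)s(s+1)/(6(n-s)), so the
-- expected number of usable vertices is at least ((s+1)(n-s) - (s-1)s(s+1)/6) / 2^s. Comparing this
-- with t-1 gives the assumed inequality.
--
-- In the small module case, passing to a majority neighborhood about halves n, while w vertices
-- fewer on the s-side lower the required n by a factor of about 2^w. For small w and t the margin
-- is thin. The comparison is therefore made only for t ≥ 3 and at least two missing vertices; the
-- other cases are settled directly.
--
-- Probabilities appear as counts over all sequences, cleared of denominators.

-- To show c ≤ d, exhibit d - c as b - a + slack; with the terms moved so that no
-- subtraction occurs, this is a semiring identity.
≤-by : ∀ {a b c d} slack → a ≤ b → c + b + slack ≡ d + a → c ≤ d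
≤-by {a} {b} {c} {d} slack a≤b eq = +-cancelʳ-≤ b c d (begin
  c + b          ≤⟨ m≤m+n (c + b) slack ⟩
  c + b + slack  ≡⟨ eq ⟩
  d + a          ≤⟨ +-monoʳ-≤ d a≤b ⟩
  d + b          ∎)
  where open ≤-Reasoning

-- Falling factorials

fall : ℕ → ℕ → ℕ
fall m       zero    = 1
fall zero    (suc k) = 0
fall (suc m) (suc k) = suc m * fall m k

-- Moving `k * fall m k` to the left avoids truncated subtraction, and the identity also covers
-- `m < k`, where every term vanishes.
fall-suc : ∀ m k → fall m (suc k) + k * fall m k ≡ m * fall m k
fall-suc zero    zero    = refl
fall-suc zero    (suc k) = *-zeroʳ k
fall-suc (suc m) zero    = +-identityʳ _
fall-suc (suc m) (suc k) = begin
  suc m * f' + suc k * (suc m * f)   ≡⟨ lhs m k f f' ⟩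
  suc m * (f' + k * f + f)           ≡⟨ cong (λ x → suc m * (x + f)) (fall-suc m k) ⟩
  suc m * (m * f + f)                ≡⟨ cong (suc m *_) (+-comm (m * f) f) ⟩
  suc m * (suc m * f)                ∎
  where
  open ≡-Reasoning
  f = fall m k
  f' = fall m (suc k)
  lhs : ∀ m k f f' → suc m * f' + suc k * (suc m * f) ≡ suc m * (f' + k * f + f)
  lhs = solve-∀

fall-mono : ∀ {m n} k → m ≤ n → fall m k ≤ fall n k
fall-mono zero    _         = ≤-refl
fall-mono (suc k) z≤n       = z≤n
fall-mono {suc m} {suc n} (suc k) (s≤s m≤n) = *-mono-≤ {suc m} {suc n} (s≤s m≤n) (fall-mono k m≤n)

fall-pos : ∀ {m} k → k ≤ m → 1 ≤ fall m k
fall-pos zero    _         = ≤-refl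
fall-pos {suc m} (suc k) (s≤s k≤m) = *-mono-≤ {1} {suc m} (s≤s z≤n) (fall-pos k k≤m)

fall-+ : ∀ p k → fall (p + k) (suc k) ≡ p * fall (p + k) k
fall-+ p k = +-cancelʳ-≡ (k * f) _ _ (trans (fall-suc (p + k) k) (*-distribʳ-+ f p k))
  where f = fall (p + k) k

-- The two sides differ by (b - a)(d - c).
chebyshev : ∀ {a b c d} → a ≤ b → c ≤ d → (a + b) * (c + d) ≤ 2 * (a * c + b * d)
chebyshev {a} {b} {c} {d} a≤b c≤d with m≤n⇒∃[o]m+o≡n a≤b | m≤n⇒∃[o]m+o≡n c≤d
... | x , refl | y , refl = ≤-by (x * y) (z≤n {0}) (eq a x c y)
  where
  eq : ∀ a x c y →
       (a + (a + x)) * (c + (c + y)) + 0 + x * y ≡ 2 * (a * c + (a + x) * (c + y)) + 0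
  eq = solve-∀

-- fall d (k+1) + fall e (k+1) counts the injective monochromatic sequences of
-- length k+1 in a pool with d vertices of one color and e of the other.
mono : ℕ → ℕ → ℕ → ℕ
mono d e k = 2 ^ k * (fall d (suc k) + fall e (suc k))

mono-comm : ∀ d e k → mono d e k ≡ mono e d k
mono-comm d e k = cong (2 ^ k *_) (+-comm (fall d (suc k)) _)

-- The convexity step: `d ≤ e` orders the falling factorials in the same way, so Chebyshev's
-- inequality applies. Its factor 2 becomes the additional factor of `2 ^ suc k`; the last term is
-- the correction from `fall-suc`.
mono-suc-≤ : ∀ {d e} k → d ≤ e →
  (d + e) * mono d e k ≤ mono d e (suc k) + 2 * suc k * mono d e k
mono-suc-≤ {d} {e} k d≤e = begin
  (d + e) * (x * (D + E))                    ≡⟨ l1 d e x D E ⟩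
  x * ((d + e) * (D + E))                    ≤⟨ *-monoʳ-≤ x (chebyshev d≤e (fall-mono (suc k) d≤e)) ⟩
  x * (2 * (d * D + e * E))                  
      ≡⟨ cong₂ (λ u v → x * (2 * (u + v))) (fall-suc d (suc k)) (fall-suc e (suc k)) ⟨
  x * (2 * ((D' + suc k * D) + (E' + suc k * E)))  ≡⟨ l2 k x D E D' E' ⟩
  2 * x * (D' + E') + 2 * suc k * (x * (D + E)) ∎
  where
  open ≤-Reasoning
  x = 2 ^ k
  D = fall d (suc k)
  E = fall e (suc k)
  D' = fall d (suc (suc k))
  E' = fall e (suc (suc k))
  l1 : ∀ d e x D E → (d + e) * (x * (D + E)) ≡ x * ((d + e) * (D + E))
  l1 = solve-∀
  l2 : ∀ k x D E D' E' → x * (2 * ((D' + suc k * D) + (E' + suc k * E))) ≡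
       2 * x * (D' + E') + 2 * suc k * (x * (D + E))
  l2 = solve-∀

mono-suc : ∀ d e k →
  (d + e) * mono d e k ≤ mono d e (suc k) + 2 * suc k * mono d e k
mono-suc d e k with ≤-total d e
... | inj₁ d≤e = mono-suc-≤ k d≤e
... | inj₂ e≤d rewrite mono-comm d e k | mono-comm d e (suc k) | +-comm d e = mono-suc-≤ k e≤d

-- δ s = 1 marks the cases s ≤ 2, where the averaging estimate is tight and a
-- strict inequality has to be assumed.
δ : ℕ → ℕ
δ (suc (suc (suc _))) = 0
δ _                   = 1

δ≤1 : ∀ k → δ k ≤ 1
δ≤1 0 = ≤-refl
δ≤1 1 = ≤-refl
δ≤1 2 = ≤-refl
δ≤1 (suc (suc (suc _))) = z≤n

private
  K≤p-bound : ∀ {K p} j M → K ≤ p → 2 * K * (j * M) ≤ 2 * j * (p * M)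
  K≤p-bound {K} {p} j M K≤p = begin
    2 * K * (j * M)  ≡⟨ e K j M ⟩
    K * (2 * j * M)  ≤⟨ *-monoˡ-≤ (2 * j * M) K≤p ⟩
    p * (2 * j * M)  ≡⟨ e' p j M ⟩
    2 * j * (p * M)  ∎
    where
    open ≤-Reasoning
    e : ∀ K j M → 2 * K * (j * M) ≡ K * (2 * j * M)
    e = solve-∀
    e' : ∀ p j M → p * (2 * j * M) ≡ 2 * j * (p * M)
    e' = solve-∀

  -- For `j ≤ p` the last hypothesis gives G' ≥ (p - j) M, a shortfall of at most `j * M` from
  -- `p * M`, which `K ≤ p` rescales. For `p ≤ j` the loss term alone suffices.
  large : ∀ {K p M G G'} j → K ≤ p → M ≤ G → (p + j) * G ≤ G' + 2 * j * G →
    2 * K * (p * M) ≤ 2 * K * G' + 2 * j * (p * M)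
  large {K} {p} {M} {G} {G'} j K≤p M≤G step with ≤-total p j
  ... | inj₁ p≤j = begin
    2 * K * (p * M)              ≤⟨ *-monoʳ-≤ (2 * K) (*-monoˡ-≤ M p≤j) ⟩
    2 * K * (j * M)              ≤⟨ K≤p-bound j M K≤p ⟩
    2 * j * (p * M)              ≤⟨ m≤n+m _ (2 * K * G') ⟩
    2 * K * G' + 2 * j * (p * M) ∎
    where open ≤-Reasoning
  ... | inj₂ j≤p with m≤n⇒∃[o]m+o≡n j≤p
  ...   | p' , refl = begin
    2 * K * ((j + p') * M)                   ≡⟨ e K j p' M ⟩
    2 * K * (p' * M) + 2 * K * (j * M)
      ≤⟨ +-mono-≤ (*-monoʳ-≤ (2 * K) (≤-trans (*-monoʳ-≤ p' M≤G) p'G≤G')) (K≤p-bound j M K≤p) ⟩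
    2 * K * G' + 2 * j * ((j + p') * M)      ∎
    where
    open ≤-Reasoning
    p'G≤G' : p' * G ≤ G'
    p'G≤G' = ≤-by 0 step (e'' j p' G G')
      where
      e'' : ∀ j p' G G' → p' * G + (G' + 2 * j * G) + 0 ≡ G' + (j + p' + j) * G
      e'' = solve-∀
    e : ∀ K j p' M → 2 * K * ((j + p') * M) ≡ 2 * K * (p' * M) + 2 * K * (j * M)
    e = solve-∀

-- Relative to all injective sequences the loss is at most k(k+1)/(2K). In the induction `K` grows
-- by one as `k` drops by one, so that `K + k ≤ m` persists. The `+ 1` against `δ` makes the
-- estimate strict from `k = 2` on.
mono-bound : ∀ {d e m} k K → d + e ≡ m → 1 ≤ K → K + k ≤ m →
  2 * K * fall m (suc k) + 1 ≤
  2 * K * mono d e k + suc k * k * fall m (suc k) + δ (suc k)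
mono-bound {d} {e} zero K refl 1≤K K+k≤m = ≤-reflexive (eq K d e (fall-suc d 0) (fall-suc e 0) (fall-suc (d + e) 0))
  where
  s : ∀ K d e → 2 * K * ((d + e) * 1) + 1 ≡ 2 * K * (1 * (d * 1 + e * 1)) + 0 + 1
  s = solve-∀
  eq : ∀ K d e {D E M} → D + 0 ≡ d * 1 → E + 0 ≡ e * 1 → M + 0 ≡ (d + e) * 1 →
       2 * K * M + 1 ≡ 2 * K * (1 * (D + E)) + 0 + 1
  eq K d e {D} {E} {M} p q r rewrite trans (sym (+-identityʳ D)) p | trans (sym (+-identityʳ E)) q
    | trans (sym (+-identityʳ M)) r = s K d e
mono-bound {d} {e} {m} (suc k) K d+e≡m 1≤K K+k≤m
  with m≤n⇒∃[o]m+o≡n (≤-trans (m≤n+m (suc k) K) K+k≤m)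
... | p , eq rewrite trans (sym eq) (+-comm (suc k) p) | fall-+ p (suc k) = goal
  where
  open ≤-Reasoning
  j = suc k
  M = fall (p + j) j
  G = mono d e k
  G' = mono d e j
  K≤p : K ≤ p
  K≤p = +-cancelʳ-≤ j K p K+k≤m
  1≤M : 1 ≤ M
  1≤M = fall-pos j (m≤n+m j p)
  step : (p + j) * G ≤ G' + 2 * j * G
  step = subst (λ x → x * G ≤ G' + 2 * j * G) d+e≡m (mono-suc d e k)
  rec : 2 * suc K * M + 1 ≤ 2 * suc K * G + j * k * M + δ j
  rec = mono-bound {d} {e} k (suc K) d+e≡m (s≤s z≤n) (≤-trans (≤-reflexive (sym (+-suc K k))) K+k≤m)
  extra : ∀ k → 1 ≤ fall (p + suc k) (suc k) → 1 ≤ suc k * k * (p * fall (p + suc k) (suc k)) + δ (suc (suc k))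
  extra zero    _   = ≤-refl
  extra (suc k) 1≤M = ≤-trans
    (*-mono-≤ {1} {suc (suc k) * suc k} (s≤s z≤n) (*-mono-≤ {1} (≤-trans 1≤K K≤p) 1≤M))
    (m≤m+n _ 0)
  goal : 2 * K * (p * M) + 1 ≤ 2 * K * G' + suc j * j * (p * M) + δ (suc j)
  goal with <-≤-connex G M
  ... | inj₂ M≤G = begin
    2 * K * (p * M) + 1                                    ≤⟨ +-mono-≤ (large j K≤p M≤G step) (extra k 1≤M) ⟩
    2 * K * G' + 2 * j * (p * M) + (j * k * (p * M) + δ (suc j)) ≡⟨ e₁ k (2 * K * G') (p * M) (δ (suc j)) ⟩
    2 * K * G' + suc j * j * (p * M) + δ (suc j)           ∎
    where
    e₁ : ∀ k x y z → x + 2 * suc k * y + (suc k * k * y + z) ≡ x + suc (suc k) * suc k * y + z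
    e₁ = solve-∀
  ... | inj₁ G<M = ≤-trans goal' (m≤m+n _ (δ (suc j)))
    where
    -- Replacing `suc K` by `K` frees 2(M - G) ≥ 2, which absorbs `δ j`.
    rec' : 2 * K * M + 1 ≤ 2 * K * G + j * k * M
    rec' = ≤-by 1 (+-mono-≤ (+-mono-≤ rec (δ≤1 j)) (*-monoʳ-≤ 2 G<M)) (e₁ K k M G (δ j))
      where
      e₁ : ∀ K k M G δ' → 2 * K * M + 1 + (2 * suc K * G + suc k * k * M + δ' + 1 + 2 * M) + 1 ≡
           2 * K * G + suc k * k * M + (2 * suc K * M + 1 + δ' + 2 * suc G)
      e₁ = solve-∀
    goal' : 2 * K * (p * M) + 1 ≤ 2 * K * G' + suc j * j * (p * M)
    goal' = begin
      2 * K * (p * M) + 1                          ≤⟨ +-monoʳ-≤ _ (≤-trans 1≤K K≤p) ⟩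
      2 * K * (p * M) + p                          ≡⟨ e₁ p K M ⟩
      p * (2 * K * M + 1)                          ≤⟨ *-monoʳ-≤ p rec' ⟩
      p * (2 * K * G + j * k * M)                  ≤⟨ ≤-by 0 (*-monoʳ-≤ (2 * K) step) (e₂ p K G G' k M) ⟩
      2 * K * G' + 2 * K * (j * G) + j * k * (p * M)
        ≤⟨ +-monoˡ-≤ (j * k * (p * M)) (+-monoʳ-≤ (2 * K * G')
             (≤-trans (*-monoʳ-≤ (2 * K) (*-monoʳ-≤ j (<⇒≤ G<M))) (K≤p-bound j M K≤p))) ⟩
      2 * K * G' + 2 * j * (p * M) + j * k * (p * M)   ≡⟨ e₃ (2 * K * G') k (p * M) ⟩
      2 * K * G' + suc j * j * (p * M)             ∎
      where
      e₁ : ∀ p K M → 2 * K * (p * M) + p ≡ p * (2 * K * M + 1)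
      e₁ = solve-∀
      e₂ : ∀ p K G G' k M → p * (2 * K * G + suc k * k * M) + 2 * K * (G' + 2 * suc k * G) + 0 ≡
           2 * K * G' + 2 * K * (suc k * G) + suc k * k * (p * M) + 2 * K * ((p + suc k) * G)
      e₂ = solve-∀
      e₃ : ∀ x k y → x + 2 * suc k * y + suc k * k * y ≡ x + suc (suc k) * suc k * y
      e₃ = solve-∀

-- This is (k-1)k(k+1), six times the sum of the losses j(j+1)/2 over j < k.
cubic : ℕ → ℕ
cubic zero    = 0
cubic (suc k) = suc (suc k) * suc k * k

cubic-suc : ∀ k → cubic (suc k) ≡ cubic k + 3 * (suc k * k)
cubic-suc zero    = refl
cubic-suc (suc k) = eq k
  where
  eq : ∀ k → suc (suc (suc k)) * suc (suc k) * suc k ≡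
       suc (suc k) * suc k * k + 3 * (suc (suc k) * suc k)
  eq = solve-∀

-- Three copies of the new layer's estimate are added to the accumulated one. They contribute 3
-- against 3δ, and `δ ≤ 1` reduces this to 1 against δ, so the newest layer alone provides the
-- strictness.
weight-step : ∀ {K S G M} k →
  6 * K * suc k * M ≤ 6 * K * S + cubic k * M →
  2 * K * M + 1 ≤ 2 * K * G + suc k * k * M + δ (suc k) →
  6 * K * suc (suc k) * M + 1 ≤ 6 * K * (S + G) + cubic (suc k) * M + δ (suc k)
weight-step {K} {S} {G} {M} k p q rewrite cubic-suc k =
  ≤-by 0 (+-mono-≤ p (+-mono-≤ (*-monoʳ-≤ 3 q) (*-monoʳ-≤ 2 (δ≤1 (suc k)))))
    (eq K k M S G (cubic k) (δ (suc k)))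
  where
  eq : ∀ K k M S G c δ' →
    6 * K * suc (suc k) * M + 1 +
      (6 * K * S + c * M + (3 * (2 * K * G + suc k * k * M + δ') + 2 * 1)) + 0 ≡
    6 * K * (S + G) + (c + 3 * (suc k * k)) * M + δ' +
      (6 * K * suc k * M + (3 * (2 * K * M + 1) + 2 * δ'))
  eq = solve-∀

private variable A B : Set

-- Averaging over injective sequences

∑ : List A → (A → ℕ) → ℕ
∑ xs f = sum (map f xs)

∑-mono : ∀ {f g : A → ℕ} xs → (∀ {x} → x ∈ xs → f x ≤ g x) → ∑ xs f ≤ ∑ xs g
∑-mono []       f≤g = z≤n
∑-mono (x ∷ xs) f≤g = +-mono-≤ (f≤g (here refl)) (∑-mono xs (f≤g ∘ there))

∑-cong : ∀ {f g : A → ℕ} xs → (∀ {x} → x ∈ xs → f x ≡ g x) → ∑ xs f ≡ ∑ xs g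
∑-cong []       f≡g = refl
∑-cong (x ∷ xs) f≡g = cong₂ _+_ (f≡g (here refl)) (∑-cong xs (f≡g ∘ there))

∑-+ : ∀ (xs : List A) (f g : A → ℕ) → ∑ xs (λ x → f x + g x) ≡ ∑ xs f + ∑ xs g
∑-+ []       f g = refl
∑-+ (x ∷ xs) f g rewrite ∑-+ xs f g = eq (f x) (g x) (∑ xs f) (∑ xs g)
  where
  eq : ∀ a b c d → a + b + (c + d) ≡ a + c + (b + d)
  eq = solve-∀

∑-*ʳ : ∀ (xs : List A) (f : A → ℕ) c → ∑ xs (λ x → f x * c) ≡ ∑ xs f * c
∑-*ʳ []       f c = refl
∑-*ʳ (x ∷ xs) f c rewrite ∑-*ʳ xs f c = sym (*-distribʳ-+ c (f x) _)

∑-const : ∀ (xs : List A) c → ∑ xs (λ _ → c) ≡ length xs * c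
∑-const []       c = refl
∑-const (x ∷ xs) c = cong (c +_) (∑-const xs c)

∑-pigeonhole : ∀ {f : A → ℕ} c xs → length xs * c < ∑ xs f → ∃[ x ] x ∈ xs × c < f x
∑-pigeonhole {f = f} c (x ∷ xs) lt with c <? f x
... | yes c<fx = x , here refl , c<fx
... | no  c≮fx =
  let y , y∈xs , c<fy = ∑-pigeonhole c xs (+-cancelˡ-< c _ _ (<-≤-trans lt (+-monoˡ-≤ _ (≮⇒≥ c≮fx))))
  in y , there y∈xs , c<fy

ind : Bool → ℕ
ind true  = 1
ind false = 0

count : (A → Bool) → List A → ℕ
count p xs = ∑ xs (ind ∘ p)

module Averaging {V : Set} (_≟_ : DecidableEquality V) where

  infixl 6 _∖_
  _∖_ : List V → V → List V
  P ∖ a = filter (λ x → ¬? (x ≟ a)) P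

  ∖-unique : ∀ {P} a → Unique P → Unique (P ∖ a)
  ∖-unique a = Unique.filter⁺ (λ x → ¬? (x ≟ a))

  ∈-∖⁻ : ∀ {P a x} → x ∈ P ∖ a → x ∈ P × x ≢ a
  ∈-∖⁻ {P} {a} = ∈-filter⁻ (λ x → ¬? (x ≟ a)) {xs = P}

  ∑-∖ : ∀ {P a} (f : V → ℕ) → Unique P → a ∈ P → f a + ∑ (P ∖ a) f ≡ ∑ P f
  ∑-∖ {x ∷ P} {a} f (x∉P ∷ P!) a∈ with x ≟ a | a∈
  ... | yes refl | _ = cong (λ Q → f x + ∑ Q f) (filter-all _ (All.map ≢-sym x∉P))
  ... | no  x≢a  | here a≡x  = contradiction (sym a≡x) x≢a
  ... | no  x≢a  | there a∈P = trans (eq (f a) (f x) _) (cong (f x +_) (∑-∖ f P! a∈P))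
    where
    eq : ∀ a b c → a + (b + c) ≡ b + (a + c)
    eq = solve-∀

  length-∖ : ∀ {P a} → Unique P → a ∈ P → suc (length (P ∖ a)) ≡ length P
  length-∖ {P} {a} P! a∈P = begin
    suc (length (P ∖ a))        ≡⟨ cong suc (trans (∑-const (P ∖ a) 1) (*-identityʳ _)) ⟨
    suc (∑ (P ∖ a) (λ _ → 1))   ≡⟨ ∑-∖ (λ _ → 1) P! a∈P ⟩
    ∑ P (λ _ → 1)               ≡⟨ trans (∑-const P 1) (*-identityʳ _) ⟩
    length P                    ∎
    where open ≡-Reasoning

  branch : (List V → List Bool → ℕ) → V → List V → List Bool → ℕ
  branch f a as cs = f (a ∷ as) (true ∷ cs) + f (a ∷ as) (false ∷ cs)

  -- The sum of f over all injective k-sequences in P and all bit strings of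
  -- length k.
  total : ℕ → List V → (List V → List Bool → ℕ) → ℕ
  total zero    P f = f [] []
  total (suc k) P f =
    ∑ P λ a → total k (P ∖ a) (branch f a)

  total-mono : ∀ {f g} k P → (∀ as cs → f as cs ≤ g as cs) → total k P f ≤ total k P g
  total-mono zero    P f≤g = f≤g [] []
  total-mono (suc k) P f≤g = ∑-mono P λ {a} _ →
    total-mono k (P ∖ a) λ as cs → +-mono-≤ (f≤g (a ∷ as) (true ∷ cs)) (f≤g (a ∷ as) (false ∷ cs))

  total-cong : ∀ {f g} k P → (∀ as cs → f as cs ≡ g as cs) → total k P f ≡ total k P g
  total-cong k P f≡g = ≤-antisym (total-mono k P λ as cs → ≤-reflexive (f≡g as cs))
                                 (total-mono k P λ as cs → ≤-reflexive (sym (f≡g as cs)))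

  total-0 : ∀ k P → total k P (λ _ _ → 0) ≡ 0
  total-0 zero    P = refl
  total-0 (suc k) P = trans (∑-cong P λ {a} _ → total-0 k (P ∖ a)) (trans (∑-const P 0) (*-zeroʳ (length P)))

  total-+ : ∀ k P f g → total k P (λ as cs → f as cs + g as cs) ≡ total k P f + total k P g
  total-+ zero    P f g = refl
  total-+ (suc k) P f g = trans (∑-cong P λ {a} _ → trans
      (total-cong k (P ∖ a) λ as cs → eq (f (a ∷ as) (true ∷ cs)) _ _ _)
      (total-+ k (P ∖ a) _ _))
    (∑-+ P _ _)
    where
    eq : ∀ a b c d → a + b + (c + d) ≡ a + c + (b + d)
    eq = solve-∀

  total-∑ : ∀ k P (xs : List A) (f : A → List V → List Bool → ℕ) →
    total k P (λ as cs → ∑ xs (λ v → f v as cs)) ≡ ∑ xs (λ v → total k P (f v))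
  total-∑ k P []       f = total-0 k P
  total-∑ k P (x ∷ xs) f = trans (total-+ k P (f x) _) (cong (total k P (f x) +_) (total-∑ k P xs f))

  total-all : ∀ k {P} (q : V → Bool) → Unique P →
    total k P (λ as _ → ind (all q as)) ≡ 2 ^ k * fall (count q P) k
  total-all zero    q P! = refl
  total-all (suc k) {P} q P! = begin
    ∑ P (λ a → total k (P ∖ a) λ as _ → ind (q a ∧ all q as) + ind (q a ∧ all q as))
      ≡⟨ ∑-cong P step ⟩
    ∑ P (λ a → ind (q a) * (2 * 2 ^ k * fall (c ∸ 1) k))
      ≡⟨ ∑-*ʳ P (ind ∘ q) _ ⟩
    c * (2 * 2 ^ k * fall (c ∸ 1) k)
      ≡⟨ eq c (2 * 2 ^ k) _ ⟩
    2 * 2 ^ k * (c * fall (c ∸ 1) k)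
      ≡⟨ cong (2 * 2 ^ k *_) (fall-pred c) ⟩
    2 * 2 ^ k * fall c (suc k) ∎
    where
    open ≡-Reasoning
    c = count q P
    eq : ∀ a b c → a * (b * c) ≡ b * (a * c)
    eq = solve-∀
    fall-pred : ∀ n → n * fall (n ∸ 1) k ≡ fall n (suc k)
    fall-pred zero    = refl
    fall-pred (suc n) = refl
    twice : ∀ a b → a * b + a * b ≡ 2 * a * b + 0
    twice = solve-∀
    step : ∀ {a} → a ∈ P →
      total k (P ∖ a) (λ as _ → ind (q a ∧ all q as) + ind (q a ∧ all q as)) ≡
      ind (q a) * (2 * 2 ^ k * fall (c ∸ 1) k)
    step {a} a∈P with q a in qa
    ... | false = total-0 k (P ∖ a)
    ... | true rewrite total-+ k (P ∖ a) (λ as _ → ind (all q as)) (λ as _ → ind (all q as))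
                     | total-all k q (∖-unique a P!) =
      trans (cong (λ n → 2 ^ k * fall n k + 2 ^ k * fall n k) count≡) (twice (2 ^ k) _)
      where
      count≡ : count q (P ∖ a) ≡ c ∸ 1
      count≡ = cong (_∸ 1) (trans (cong (_+ count q (P ∖ a)) (sym (cong ind qa))) (∑-∖ (ind ∘ q) P! a∈P))

  record Sequence (k : ℕ) (P : List V) (Q : List V → List Bool → Set) : Set where
    constructor sequence
    field
      {vertices} : List V
      {bits}     : List Bool
      length-vertices : length vertices ≡ k
      length-bits     : length bits ≡ k
      vertices∈  : All (_∈ P) vertices
      unique     : Unique vertices
      holds      : Q vertices bits

  private
    rearrange : ∀ x m y τ → 2 * x * (suc m * y) * τ ≡ suc m * (x * y * (τ + τ))
    rearrange = solve-∀

    halve : ∀ {x y} τ → τ + τ < x + y → τ < x ⊎ τ < y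
    halve {x} {y} τ lt with τ <? x | τ <? y
    ... | yes p | _     = inj₁ p
    ... | no  _ | yes p = inj₂ p
    ... | no  p | no  p' = contradiction lt (≤⇒≯ (+-mono-≤ (≮⇒≥ p) (≮⇒≥ p')))

  -- The threshold doubles with each chosen vertex because `branch` adds the values for both of its
  -- bits; `halve` then selects a bit that keeps the value above `τ`.
  total-pigeonhole : ∀ {f} k P τ → Unique P → 2 ^ k * fall (length P) k * τ < total k P f →
    Sequence k P (λ as cs → τ < f as cs)
  total-pigeonhole zero P τ P! lt = sequence refl refl [] [] (≤-<-trans (≤-reflexive (sym (+-identityʳ τ))) lt)
  total-pigeonhole (suc k) [] τ P! ()
  total-pigeonhole {f} (suc k) P@(x ∷ P′) τ P! lt
    with a , a∈P , lt′ ← ∑-pigeonhole {f = λ a → total k (P ∖ a) (branch f a)}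
      (2 ^ k * fall (length P′) k * (τ + τ)) P
      (subst (_< total (suc k) P f) (rearrange (2 ^ k) (length P′) (fall (length P′) k) τ) lt)
    with sequence {as} {cs} l l′ as∈ as! τ+τ< ← total-pigeonhole {branch f a} k (P ∖ a) (τ + τ) (∖-unique a P!)
      (subst (λ n → 2 ^ k * fall n k * (τ + τ) < total k (P ∖ a) (branch f a))
        (sym (suc-injective (length-∖ P! a∈P))) lt′) =
    let as∈P = All.map (proj₁ ∘ ∈-∖⁻) as∈
        a∉as = All.map (≢-sym ∘ proj₂ ∘ ∈-∖⁻) as∈
    in [ sequence {vertices = a ∷ as} {true ∷ cs} (cong suc l) (cong suc l′) (a∈P ∷ as∈P) (a∉as ∷ as!)
       , sequence {vertices = a ∷ as} {false ∷ cs} (cong suc l) (cong suc l′) (a∈P ∷ as∈P) (a∉as ∷ as!)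
       ]′ (halve τ τ+τ<)

-- n ≥ 2^s/(s+1) τ + s(s+5)/6, strictly if s ≤ 2, where τ stands for t - 1.
record Suffices (s τ n : ℕ) : Set where
  constructor suffices
  field bound : 6 * 2 ^ s * τ + suc s * s * (s + 5) + δ s ≤ 6 * suc s * n

open Suffices public

-- Already the case τ = 0 gives this: for S = `suc s`, the constant S(S+5)/6 exceeds S when S ≥ 2,
-- and at S = 1, where both agree, `δ` supplies the strictness.
Suffices⇒< : ∀ {s τ n} → Suffices (suc s) τ n → suc s < n
Suffices⇒< {s} {τ} {n} c = *-cancelˡ-< (6 * suc (suc s)) (suc s) n (≤-trans (go s) (bound c))
  where
  go : ∀ s → suc (6 * suc (suc s) * suc s) ≤
       6 * 2 ^ suc s * τ + suc (suc s) * suc s * (suc s + 5) + δ (suc s)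
  go 0 = ≤-trans (≤-reflexive refl) (+-monoˡ-≤ 1 (m≤n+m 12 _))
  go 1 = ≤-trans (m≤m+n 37 6) (+-monoˡ-≤ 1 (m≤n+m 42 _))
  go (suc (suc s)) = ≤-trans
    (≤-trans (≤-by (s * s * s + 9 * (s * s) + 26 * s + 23) (z≤n {0}) (eq s)) (m≤n+m _ _)) (m≤m+n _ 0)
    where
    eq : ∀ s → suc (6 * suc (suc (suc (suc s))) * suc (suc (suc s))) + 0 + (s * s * s + 9 * (s * s) + 26 * s + 23) ≡
      suc (suc (suc (suc s))) * suc (suc (suc s)) * (suc (suc (suc s)) + 5) + 0
    eq = solve-∀

-- The expected number of vertices that fit into the ordering

module Cover {V : Set} (_≟_ : DecidableEquality V) (β : V → V → Bool) where
  open Averaging _≟_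

  -- `β u v` is meant to tell whether `u` sees `v` in a reference color belonging to `u`, so `β`
  -- need not be symmetric. A bit at `u` selects the vertices seen in that color or those seen in
  -- another one.
  hit : Bool → Bool → Bool
  hit true  x = x
  hit false x = not x

  other : V → V → Bool
  other v a = not (does (a ≟ v))

  same : Bool → V → V → Bool
  same b v a = other v a ∧ hit b (β v a)

  -- v can be inserted into the ordering of the vertices as with color bits
  -- cs: it agrees with the bits up to some point and sees the rest of as in a
  -- single color.
  covers : V → List V → List Bool → Bool
  covers v []       _        = true
  covers v (a ∷ as) []       = false
  covers v (a ∷ as) (c ∷ cs) =
    (other v a ∧ hit c (β a v) ∧ covers v as cs) ∨
    (all (same true v) (a ∷ as) ∨ all (same false v) (a ∷ as))

  covered : V → List V → List Bool → ℕ
  covered v as cs = ind (covers v as cs)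

  private
    -- Exactly one value of the bit agrees with `x`, and that value accounts for `z`. A
    -- monochromatic end makes both values succeed, which pays for itself and for `z`; the two
    -- possible ends exclude each other through `y`.
    bits : ∀ o x z {y m n} →
      ind (o ∧ z) + (ind ((o ∧ y) ∧ m) + ind ((o ∧ not y) ∧ n)) ≤
      ind ((o ∧ x ∧ z) ∨ (((o ∧ y) ∧ m) ∨ ((o ∧ not y) ∧ n))) +
      ind ((o ∧ not x ∧ z) ∨ (((o ∧ y) ∧ m) ∨ ((o ∧ not y) ∧ n)))
    bits false x     z     = z≤n
    bits true  false false {false} {n = false} = z≤n
    bits true  false false {false} {n = true} = s≤s z≤n
    bits true  false false {true} {false}  = z≤n
    bits true  false false {true} {true} = s≤s z≤n
    bits true  false true {false} {n = false} = s≤s z≤n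
    bits true  false true {false} {n = true} = s≤s (s≤s z≤n)
    bits true  false true {true} {false}  = s≤s z≤n
    bits true  false true {true} {true} = s≤s (s≤s z≤n)
    bits true  true false {false} {n = false} = z≤n
    bits true  true false {false} {n = true} = s≤s z≤n
    bits true  true false {true} {false}  = z≤n
    bits true  true false {true} {true} = s≤s z≤n
    bits true  true true {false} {n = false} = s≤s z≤n
    bits true  true true {false} {n = true} = s≤s (s≤s z≤n)
    bits true  true true {true} {false}  = s≤s z≤n
    bits true  true true {true} {true} = s≤s (s≤s z≤n)

  module _ (v : V) where

    ends : Bool → ℕ → List V → ℕ
    ends b k P = ∑ P λ a → total k (P ∖ a) λ as _ → ind (all (same b v) (a ∷ as))

    ends≡ : ∀ b k {P} → Unique P → ends b k P ≡ 2 ^ k * fall (count (same b v) P) (suc k)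
    -- `total-all` also counts the bit of the first vertex, which `ends` omits; hence the factor 2.
    ends≡ b k {P} P! = *-cancelˡ-≡ _ _ 2 (begin
      2 * ends b k P                                ≡⟨ cong (ends b k P +_) (+-identityʳ _) ⟩
      ends b k P + ends b k P                       ≡⟨ ∑-+ P _ _ ⟨
      ∑ P (λ a → X a + X a)                         
        ≡⟨ ∑-cong P (λ {a} _ → total-+ k (P ∖ a) (λ as _ → ind (all (same b v) (a ∷ as))) _) ⟨
      total (suc k) P (λ as _ → ind (all (same b v) as))  ≡⟨ total-all (suc k) (same b v) P! ⟩
      2 * 2 ^ k * F                                 ≡⟨ *-assoc 2 (2 ^ k) F ⟩
      2 * (2 ^ k * F)                               ∎)
      where
      open ≡-Reasoning
      F = fall (count (same b v) P) (suc k)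
      X : V → ℕ
      X a = total k (P ∖ a) λ as _ → ind (all (same b v) (a ∷ as))

    total-ind : ∀ b k P (f : List V → List Bool → Bool) →
      total k P (λ as cs → ind (b ∧ f as cs)) ≡ ind b * total k P (λ as cs → ind (f as cs))
    total-ind false k P f = total-0 k P
    total-ind true  k P f = sym (+-identityʳ _)

    matching : ℕ → List V → ℕ
    matching k P = ∑ P λ a → ind (other v a) * total k (P ∖ a) (covered v)

    -- This is `bits` summed over all sequences: `v` goes after the first vertex if it agrees with
    -- its bit, and before it if it sees the whole sequence in one color.
    total-covered-suc : ∀ k {P} → Unique P →
      matching k P + mono (count (same true v) P) (count (same false v) P) k ≤
      total (suc k) P (covered v)
    total-covered-suc k {P} P! = begin
      matching k P + mono (count (same true v) P) (count (same false v) P) k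
        ≡⟨ cong (matching k P +_) (*-distribˡ-+ (2 ^ k) _ _) ⟩
      matching k P + (2 ^ k * fall (count (same true v) P) (suc k) + 2 ^ k * fall (count (same false v) P) (suc k))
        ≡⟨ cong (matching k P +_) (cong₂ _+_ (ends≡ true k P!) (ends≡ false k P!)) ⟨
      matching k P + (ends true k P + ends false k P)
        ≡⟨ trans (∑-+ P _ _) (cong (matching k P +_) (∑-+ P _ _)) ⟨
      ∑ P (λ a → ind (other v a) * total k (P ∖ a) (covered v) + (X true a + X false a))
        ≡⟨ ∑-cong P (λ {a} _ → trans
             (total-+ k (P ∖ a) (λ as cs → ind (other v a ∧ covers v as cs)) _)
             (cong₂ _+_ (total-ind (other v a) k (P ∖ a) (covers v))
                        (total-+ k (P ∖ a) (Y true a) (Y false a)))) ⟨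
      ∑ P (λ a → total k (P ∖ a) λ as cs →
        ind (other v a ∧ covers v as cs) +
        (ind (all (same true v) (a ∷ as)) + ind (all (same false v) (a ∷ as))))
        ≤⟨ ∑-mono P (λ {a} _ → total-mono k (P ∖ a) λ as cs →
             bits (other v a) (β a v) (covers v as cs) {β v a} {all (same true v) as} {all (same false v) as}) ⟩
      total (suc k) P (covered v) ∎
      where
      open ≤-Reasoning
      Y : Bool → V → List V → List Bool → ℕ
      Y b a as _ = ind (all (same b v) (a ∷ as))
      X : Bool → V → ℕ
      X b a = total k (P ∖ a) (Y b a)

    count-same : ∀ P → count (same true v) P + count (same false v) P ≡ count (other v) P
    count-same P = trans (sym (∑-+ P _ _)) (∑-cong P λ {a} _ → split (other v a) (β v a))
      where
      split : ∀ o x → ind (o ∧ x) + ind (o ∧ not x) ≡ ind o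
      split false x     = refl
      split true  false = refl
      split true  true  = refl

    -- Each possible length of the final run, from 0 to `k`, contributes one unit of weight
    -- `fall m k`, where m is the number of vertices of `P` other than `v`; `cubic` collects the
    -- losses. `K` stays fixed in the induction, because removing a vertex lowers both `k` and m by
    -- one.
    total-covered : ∀ k {P K} → Unique P → 1 ≤ K → K + k ≡ suc (count (other v) P) →
      6 * K * suc k * fall (count (other v) P) k + 1 ≤
      6 * K * total k P (covered v) + cubic k * fall (count (other v) P) k + δ k
    total-covered zero    {K = K} P! 1≤K eq = ≤-reflexive (e K)
      where
      e : ∀ K → 6 * K * 1 * 1 + 1 ≡ 6 * K * 1 + 0 * 1 + 1
      e = solve-∀
    total-covered (suc k) {P} {K} P! 1≤K eq = ≤-trans
      (weight-step {K} {matching k P} k matching≥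
        (mono-bound {count (same true v) P} {count (same false v) P} k K (count-same P) 1≤K (≤-reflexive K+k≡m)))
      (+-monoˡ-≤ (δ (suc k)) (+-monoˡ-≤ _ (*-monoʳ-≤ (6 * K) (total-covered-suc k P!))))
      where
      m = count (other v) P
      K+k≡m : K + k ≡ m
      K+k≡m = suc-injective (trans (sym (+-suc K k)) eq)
      M′ = fall (m ∸ 1) k
      M = fall m (suc k)
      M≡ : M ≡ m * M′
      M≡ with m
      ... | zero  = refl
      ... | suc _ = refl
      each : ∀ {a} → a ∈ P → ind (other v a) * (6 * K * suc k * M′) ≤
        ind (other v a) * total k (P ∖ a) (covered v) * (6 * K) + ind (other v a) * (cubic k * M′)
      each {a} a∈P with other v a in oa
      ... | false = z≤n
      ... | true  = ≤-by 0 rec′ (e (6 * K) (suc k) M′ _ (cubic k))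
        where
        size : suc (count (other v) (P ∖ a)) ≡ m
        size = trans (cong (_+ count (other v) (P ∖ a)) (sym (cong ind oa)))
          (∑-∖ (ind ∘ other v) P! a∈P)
        rec : 6 * K * suc k * M′ + 1 ≤ 6 * K * total k (P ∖ a) (covered v) + cubic k * M′ + δ k
        rec = subst (λ n → 6 * K * suc k * fall n k + 1 ≤
                           6 * K * total k (P ∖ a) (covered v) + cubic k * fall n k + δ k)
          (cong (_∸ 1) size) (total-covered k (∖-unique a P!) 1≤K (trans K+k≡m (sym size)))
        -- Strictness from the shorter sequences is given up here; `weight-step` regains it from the
        -- newest layer.
        rec′ : 6 * K * suc k * M′ ≤ 6 * K * total k (P ∖ a) (covered v) + cubic k * M′
        rec′ = +-cancelʳ-≤ 1 _ _ (≤-trans rec (+-monoʳ-≤ _ (δ≤1 k)))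
        e : ∀ K k M t c → 1 * (K * k * M) + (K * t + c * M) + 0 ≡ 1 * t * K + 1 * (c * M) + K * k * M
        e = solve-∀
      matching≥ : 6 * K * suc k * M ≤ 6 * K * matching k P + cubic k * M
      matching≥ = begin
        6 * K * suc k * M                ≡⟨ cong (6 * K * suc k *_) M≡ ⟩
        6 * K * suc k * (m * M′)         ≡⟨ e₁ (6 * K) (suc k) m M′ ⟩
        m * (6 * K * suc k * M′)         ≡⟨ ∑-*ʳ P _ _ ⟨
        ∑ P (λ a → ind (other v a) * (6 * K * suc k * M′))  ≤⟨ ∑-mono P each ⟩
        ∑ P (λ a → ind (other v a) * total k (P ∖ a) (covered v) * (6 * K) + ind (other v a) * (cubic k * M′))
          ≡⟨ trans (∑-+ P _ _) (cong₂ _+_ (∑-*ʳ P _ (6 * K)) (∑-*ʳ P _ (cubic k * M′))) ⟩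
        matching k P * (6 * K) + m * (cubic k * M′)   ≡⟨ e₂ (6 * K) (matching k P) m (cubic k) M′ ⟩
        6 * K * matching k P + cubic k * (m * M′)     ≡⟨ cong (λ x → 6 * K * matching k P + cubic k * x) M≡ ⟨
        6 * K * matching k P + cubic k * M            ∎
        where
        open ≤-Reasoning
        e₁ : ∀ K k m M → K * k * (m * M) ≡ m * (K * k * M)
        e₁ = solve-∀
        e₂ : ∀ K x m c M → x * K + m * (c * M) ≡ K * x + c * (m * M)
        e₂ = solve-∀

  count-other : ∀ {P v} → Unique P → v ∈ P → suc (count (other v) P) ≡ length P
  count-other {P} {v} P! v∈P = trans (cong suc (count-∖ P)) (length-∖ P! v∈P)
    where
    count-∖ : ∀ P → count (other v) P ≡ length (P ∖ v)
    count-∖ []      = refl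
    count-∖ (x ∷ P) with does (x ≟ v)
    ... | true  = count-∖ P
    ... | false = cong suc (count-∖ P)

  private
    -- The two sources of strictness: for d = 0 the averaging estimate at each of the n vertices,
    -- for d = 1 the assumption of a strict inequality in `Suffices`.
    exclude : ∀ n d X → 1 ≤ n → 1 ≤ X → d ≤ 1 → ¬ n + d * X ≤ n * d
    exclude n 0 X 1≤n 1≤X d≤1 le = <⇒≱ 1≤n
      (≤-trans (m≤m+n n 0) (≤-trans le (≤-reflexive (*-zeroʳ n))))
    exclude n 1 X 1≤n 1≤X d≤1 le = <⇒≱ 1≤X (≤-by 0 le (eq n X))
      where
      eq : ∀ n X → X + n * 1 + 0 ≡ 0 + (n + 1 * X)
      eq = solve-∀
    exclude n (suc (suc d)) X 1≤n 1≤X (s≤s ()) le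

  -- If every choice had at most `τ` covered vertices, summing `total-covered` over `W` would
  -- contradict `Suffices`. Each v draws from its n - 1 other vertices;
  -- `n * fall (n ∸ 1) k = K * fall n k` with K = n - k puts both sides over the same count of
  -- sequences.
  averaging : ∀ {s τ W} → Unique W → Suffices (suc s) τ (length W) →
    Sequence (suc s) W λ as cs → τ < ∑ W λ v → covered v as cs
  averaging {s} {τ} {W} W! cond with m≤n⇒∃[o]m+o≡n (<⇒≤ (Suffices⇒< {s} {τ} cond))
  ... | K , k+K≡n = total-pigeonhole k W τ W! (≰⇒> λ few →
    exclude n (δ k) (K * Z) (≤-trans (s≤s z≤n) (<⇒≤ (Suffices⇒< {s} {τ} cond)))
      (*-mono-≤ 1≤K (fall-pos {n} k (<⇒≤ (Suffices⇒< {s} {τ} cond)))) (δ≤1 k)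
      (≤-by 0 (+-mono-≤ (sumBound few) condKZ) (rearranged s (2 ^ k) τ K Z n (δ k))))
    where
    open ≤-Reasoning
    k = suc s
    n = length W
    Z = fall n k
    M = fall (n ∸ 1) k
    K+k≡n : K + k ≡ n
    K+k≡n = trans (+-comm K k) k+K≡n
    1≤K : 1 ≤ K
    1≤K = +-cancelʳ-≤ k 1 K (≤-trans (Suffices⇒< {s} {τ} cond) (≤-reflexive (sym K+k≡n)))
    nM≡ : ∀ n → n * fall (n ∸ 1) k ≡ fall n (suc k)
    nM≡ zero    = refl
    nM≡ (suc _) = refl
    nM≡KZ : n * M ≡ K * Z
    nM≡KZ = trans (nM≡ n) (subst (λ n → fall n (suc k) ≡ K * fall n k) K+k≡n (fall-+ K k))
    each : ∀ {v} → v ∈ W →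
      6 * K * suc k * M + 1 ≤ total k W (covered v) * (6 * K) + (cubic k * M + δ k)
    each {v} v∈W = ≤-trans
      (subst (λ m → 6 * K * suc k * fall m k + 1 ≤ 6 * K * total k W (covered v) + cubic k * fall m k + δ k)
        (cong (_∸ 1) (count-other W! v∈W))
        (total-covered v k W! 1≤K (trans K+k≡n (sym (count-other W! v∈W)))))
      (≤-reflexive (trans (+-assoc (6 * K * total k W (covered v)) _ _)
        (cong (_+ (cubic k * M + δ k)) (*-comm (6 * K) (total k W (covered v))))))
    sumBound : total k W (λ as cs → ∑ W λ v → covered v as cs) ≤ 2 ^ k * Z * τ →
      n + 6 * K * suc k * (K * Z) ≤ 6 * K * (2 ^ k * Z * τ) + (cubic k * (K * Z) + n * δ k)
    sumBound few = begin
      n + 6 * K * suc k * (K * Z)           ≡⟨ cong (λ x → n + 6 * K * suc k * x) nM≡KZ ⟨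
      n + 6 * K * suc k * (n * M)           ≡⟨ e₁ n (6 * K * suc k) M ⟩
      n * (6 * K * suc k * M + 1)           ≡⟨ ∑-const W _ ⟨
      ∑ W (λ _ → 6 * K * suc k * M + 1)     ≤⟨ ∑-mono W each ⟩
      ∑ W (λ v → total k W (covered v) * (6 * K) + (cubic k * M + δ k))
        ≡⟨ trans (∑-+ W _ _) (cong₂ _+_ (∑-*ʳ W _ (6 * K)) (∑-const W _)) ⟩
      ∑ W (λ v → total k W (covered v)) * (6 * K) + n * (cubic k * M + δ k)
        ≡⟨ cong (λ x → x * (6 * K) + n * (cubic k * M + δ k)) (total-∑ k W W covered) ⟨
      total k W (λ as cs → ∑ W λ v → covered v as cs) * (6 * K) + n * (cubic k * M + δ k)
        ≤⟨ +-monoˡ-≤ _ (*-monoˡ-≤ (6 * K) few) ⟩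
      2 ^ k * Z * τ * (6 * K) + n * (cubic k * M + δ k)
        ≡⟨ e₂ (2 ^ k * Z * τ) (6 * K) n (cubic k) M (δ k) ⟩
      6 * K * (2 ^ k * Z * τ) + (cubic k * (n * M) + n * δ k)
        ≡⟨ cong (λ x → 6 * K * (2 ^ k * Z * τ) + (cubic k * x + n * δ k)) nM≡KZ ⟩
      6 * K * (2 ^ k * Z * τ) + (cubic k * (K * Z) + n * δ k) ∎
      where
      e₁ : ∀ n x M → n + x * (n * M) ≡ n * (x * M + 1)
      e₁ = solve-∀
      e₂ : ∀ a b n c M d → a * b + n * (c * M + d) ≡ b * a + (c * (n * M) + n * d)
      e₂ = solve-∀
    condKZ : (6 * 2 ^ k * τ + suc k * k * (k + 5) + δ k) * (K * Z) ≤ 6 * suc k * (K + k) * (K * Z)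
    condKZ = *-monoˡ-≤ (K * Z)
      (subst (λ n → 6 * 2 ^ k * τ + suc k * k * (k + 5) + δ k ≤ 6 * suc k * n) (sym K+k≡n) (bound cond))
    rearranged : ∀ s x τ K Z n d →
      n + d * (K * Z) +
        (6 * K * (x * Z * τ) + (suc (suc s) * suc s * s * (K * Z) + n * d) +
         6 * suc (suc s) * (K + suc s) * (K * Z)) + 0 ≡
      n * d + (n + 6 * K * suc (suc s) * (K * Z) +
        (6 * x * τ + suc (suc s) * suc s * (suc s + 5) + d) * (K * Z))
    rearranged = solve-∀

-- Modules in colorings without rainbow triangles

∈⇒1≤length : ∀ {A : Set} {x : A} {xs} → x ∈ xs → 1 ≤ length xs
∈⇒1≤length (here _)  = s≤s z≤n
∈⇒1≤length (there _) = s≤s z≤n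

length-filter-⊆ : ∀ {A : Set} {P Q : A → Set} (P? : Decidable P) (Q? : Decidable Q) →
  (∀ {x} → P x → Q x) → ∀ xs → length (filter P? xs) ≤ length (filter Q? xs)
length-filter-⊆ P? Q? P⊆Q []       = z≤n
length-filter-⊆ P? Q? P⊆Q (x ∷ xs) with P? x | Q? x
... | yes _ | yes _  = s≤s (length-filter-⊆ P? Q? P⊆Q xs)
... | yes p | no  ¬q = contradiction (P⊆Q p) ¬q
... | no  _ | yes _  = m≤n⇒m≤1+n (length-filter-⊆ P? Q? P⊆Q xs)
... | no  _ | no  _  = length-filter-⊆ P? Q? P⊆Q xs

length-filter-⊂ : ∀ {A : Set} {P Q : A → Set} (P? : Decidable P) (Q? : Decidable Q) →
  (∀ {x} → P x → Q x) → ∀ {x xs} → x ∈ xs → ¬ P x → Q x →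
  length (filter P? xs) < length (filter Q? xs)
length-filter-⊂ P? Q? P⊆Q {xs = y ∷ xs} x∈ ¬px qx with P? y | Q? y | x∈
... | yes p | no  ¬q | _         = contradiction (P⊆Q p) ¬q
... | yes p | yes _  | here refl = contradiction p ¬px
... | yes _ | yes _  | there x∈′ = s≤s (length-filter-⊂ P? Q? P⊆Q x∈′ ¬px qx)
... | no  _ | yes _  | here refl = s≤s (length-filter-⊆ P? Q? P⊆Q xs)
... | no  _ | yes _  | there x∈′ = m≤n⇒m≤1+n (length-filter-⊂ P? Q? P⊆Q x∈′ ¬px qx)
... | no  _ | no  ¬q | here refl = contradiction qx ¬q
... | no  _ | no  _  | there x∈′ = length-filter-⊂ P? Q? P⊆Q x∈′ ¬px qx

length-filter-∁ : ∀ {A : Set} {P : A → Set} (P? : Decidable P) xs →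
  length (filter P? xs) + length (filter (¬? ∘ P?) xs) ≡ length xs
length-filter-∁ P? []       = refl
length-filter-∁ P? (x ∷ xs) with P? x
... | yes _ = cong suc (length-filter-∁ P? xs)
... | no  _ = trans (+-suc _ _) (cong suc (length-filter-∁ P? xs))

module Gallai {V C : Set} (_≟_ : DecidableEquality V) (_≟ᶜ_ : DecidableEquality C)
  (χ : V → V → C) (χ-sym : ∀ u v → χ u v ≡ χ v u)
  (gallai : ∀ {x y z} → x ≢ y → y ≢ z → x ≢ z → χ x y ≢ χ y z →
            χ x z ≡ χ x y ⊎ χ x z ≡ χ y z) where

  avoid : ∀ {x y z c} → x ≢ y → y ≢ z → x ≢ z → χ x y ≢ χ y z →
          χ x y ≢ c → χ y z ≢ c → χ x z ≢ c
  avoid x≢y y≢z x≢z xy≢yz xy≢c yz≢c xz≡c with gallai x≢y y≢z x≢z xy≢yz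
  ... | inj₁ eq = xy≢c (trans (sym eq) xz≡c)
  ... | inj₂ eq = yz≢c (trans (sym eq) xz≡c)

  Closed : C → List V → (V → Set) → Set
  Closed c W D = ∀ {x y} → x ∈ W → y ∈ W → D x → ¬ D y → χ x y ≢ c

  -- Disconnectedness of color `c` on `W`, witnessed by any union of components with vertices on
  -- both sides, so that no component has to be computed.
  record Cut (c : C) (W : List V) : Set₁ where
    field
      D      : V → Set
      D?     : Decidable D
      inside : V
      inside∈ : inside ∈ W
      D-inside : D inside
      outside : V
      outside∈ : outside ∈ W
      ¬D-outside : ¬ D outside
      closed : Closed c W D

  cut⊎edge : ∀ c {W x y} (D : V → Set) → Decidable D → x ∈ W → D x → y ∈ W → ¬ D y →
    Cut c W ⊎ (∃₂ λ p q → p ∈ W × q ∈ W × D p × ¬ D q × χ p q ≡ c)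
  cut⊎edge c {W} D D? x∈ Dx y∈ ¬Dy
    with Any.any? (λ p → Any.any? (λ q → D? p ×-dec ¬? (D? q) ×-dec (χ p q ≟ᶜ c)) W) W
  ... | yes found = inj₂ (let p , p∈ , found′ = find found
                              q , q∈ , Dp , ¬Dq , eq = find found′
                          in p , q , p∈ , q∈ , Dp , ¬Dq , eq)
  ... | no  none  = inj₁ record
    { D? = D? ; inside∈ = x∈ ; D-inside = Dx ; outside∈ = y∈ ; ¬D-outside = ¬Dy
    ; closed = λ p∈ q∈ Dp ¬Dq eq → none (lose p∈ (lose q∈ (Dp , ¬Dq , eq))) }

  closed-∁ : ∀ {c W D} → Decidable D → Closed c W D → Closed c W (¬_ ∘ D)
  closed-∁ D? closed {x} {y} x∈ y∈ ¬Dx ¬¬Dy eq =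
    closed y∈ x∈ (decidable-stable (D? y) ¬¬Dy) ¬Dx (trans (χ-sym y x) eq)

  -- The color of an edge to a vertex outside a closed set is constant along
  -- the edges of color i inside that set.
  closed-refine : ∀ {i W D} j {z} → z ∈ W → Closed i W D → Decidable D → ¬ D z →
    Unique W → Closed i W (λ w → D w × χ w z ≡ j)
  closed-refine {i} {W} {D} j {z} z∈ closed D? ¬Dz W! {p} {q} p∈ q∈ (Dp , pz≡j) ¬D′q with D? q
  ... | no  ¬Dq = closed p∈ q∈ Dp ¬Dq
  ... | yes Dq  = avoid (λ { refl → ¬Dz Dp }) (λ { refl → ¬Dz Dq }) p≢q
      (λ eq → ¬D′q (Dq , trans (χ-sym q z) (trans (sym eq) pz≡j)))
      (closed p∈ z∈ Dp ¬Dz) (λ eq → closed q∈ z∈ Dq ¬Dz (trans (χ-sym q z) eq))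
    where
    p≢q : p ≢ q
    p≢q refl = ¬D′q (Dq , pz≡j)

  module _ {v : V} {W : List V} (v∷W! : Unique (v ∷ W)) where

    private
      v∉ : ∀ {x} → x ∈ W → x ≢ v
      v∉ x∈ refl = All.lookup (AllPairs.head v∷W!) x∈ refl

      W! : Unique W
      W! = AllPairs.tail v∷W!

      split : ∀ {x} → x ∈ v ∷ W → x ≡ v ⊎ x ∈ W
      split (here eq)  = inj₁ eq
      split (there x∈) = inj₂ x∈

    -- The part of `D` that `x′` sees in color `j` remains closed under `i` within `W`. An edge of
    -- color `i` from it to `v` would form a rainbow triangle with `x′`, with colors i, l and j.
    separated′ : ∀ {i j l D x x′} → i ≢ j → i ≢ l → j ≢ l → Decidable D → Closed i W D →
      x ∈ W → D x → x′ ∈ W → ¬ D x′ → χ v x′ ≡ l → χ x x′ ≡ j → Cut i (v ∷ W)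
    separated′ {i} {j} {l} {D} {x} {x′} i≢j i≢l j≢l D? closed x∈ Dx x′∈ ¬Dx′ vx′ xx′
      with cut⊎edge i (λ z → (D z × χ z x′ ≡ j) × z ≢ v)
             (λ z → (D? z ×-dec (χ z x′ ≟ᶜ j)) ×-dec ¬? (z ≟ v))
             (there x∈) ((Dx , xx′) , v∉ x∈) (there x′∈) (λ S → ¬Dx′ (proj₁ (proj₁ S)))
    ... | inj₁ cut = cut
    ... | inj₂ (p , q , p∈ , q∈ , ((Dp , px′) , p≢v) , ¬Sq , pq≡i) with split p∈ | split q∈
    ...   | inj₁ p≡v | _         = contradiction p≡v p≢v
    ...   | inj₂ p∈W | inj₂ q∈W  = contradiction pq≡i
        (closed-refine j x′∈ closed D? ¬Dx′ W! p∈W q∈W (Dp , px′) (λ Sq → ¬Sq (Sq , v∉ q∈W)))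
    ...   | inj₂ p∈W | inj₁ refl = contradiction px′
        (avoid p≢v (≢-sym (v∉ x′∈)) (λ { refl → ¬Dx′ Dp })
          (λ eq → i≢l (trans (sym pq≡i) (trans eq vx′)))
          (λ eq → i≢j (trans (sym pq≡i) eq))
          (λ eq → j≢l (trans (sym eq) vx′)))

    -- The edge from `x` to `x′` has color `j` or `l`. The second case is the first with the two
    -- sides of `D` and the two colors exchanged.
    separated : ∀ {i j l D x x′} → i ≢ j → i ≢ l → j ≢ l → Decidable D → Closed i W D →
      x ∈ W → D x → χ v x ≡ j → x′ ∈ W → ¬ D x′ → χ v x′ ≡ l → Cut i (v ∷ W)
    separated {x = x} {x′} i≢j i≢l j≢l D? closed x∈ Dx vx x′∈ ¬Dx′ vx′
      with gallai (v∉ x∈) (≢-sym (v∉ x′∈)) (λ { refl → ¬Dx′ Dx })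
             (λ eq → j≢l (trans (sym vx) (trans (χ-sym v x) (trans eq vx′))))
    ... | inj₁ eq = separated′ i≢j i≢l j≢l D? closed x∈ Dx x′∈ ¬Dx′ vx′ (trans eq (trans (χ-sym x v) vx))
    ... | inj₂ eq = separated′ i≢l i≢j (≢-sym j≢l) (¬? ∘ D?) (closed-∁ D? closed) x′∈ ¬Dx′ x∈ (λ ¬Dx → ¬Dx Dx) vx
                      (trans (χ-sym x′ x) (trans eq vx′))

    -- Since `D` is closed, `y` sees `x` and `x′` in colors other than `i`; the triangles with `v`
    -- then force `j` and `l`. Refining `D` by the color towards `y` therefore separates `x` from
    -- `x′`.
    together : ∀ {i j l D x x′ y} → i ≢ j → i ≢ l → j ≢ l → Decidable D → Closed i W D →
      x ∈ W → D x → χ v x ≡ j → x′ ∈ W → D x′ → χ v x′ ≡ l →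
      y ∈ W → ¬ D y → χ v y ≡ i → Cut i (v ∷ W)
    together {i} {j} {l} {D} {x} {x′} {y} i≢j i≢l j≢l D? closed x∈ Dx vx x′∈ Dx′ vx′ y∈ ¬Dy vy =
      separated i≢j i≢l j≢l (λ z → D? z ×-dec (χ z y ≟ᶜ j)) (closed-refine j y∈ closed D? ¬Dy W!)
        x∈ (Dx , third x∈ Dx vx (≢-sym i≢j)) vx
        x′∈ (λ (_ , eq) → j≢l (trans (sym eq) (third x′∈ Dx′ vx′ (≢-sym i≢l)))) vx′
      where
      third : ∀ {x c} → x ∈ W → D x → χ v x ≡ c → c ≢ i → χ x y ≡ c
      third {x} x∈ Dx vx c≢i
        with gallai (v∉ x∈) (≢-sym (v∉ y∈)) (λ { refl → ¬Dy Dx })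
               (λ eq → c≢i (trans (sym vx) (trans (χ-sym v x) (trans eq vy))))
      ... | inj₁ eq = trans eq (trans (χ-sym x v) vx)
      ... | inj₂ eq = contradiction (trans eq vy) (closed x∈ y∈ Dx ¬Dy)

    -- Four candidates are tried: the old side without `v`, the old side with `v`, and `v` alone for
    -- `j` and for `l`. If all fail, `v` has edges of color `i` to both sides and edges of colors
    -- `j` and `l`; what remains depends on which sides the latter two end in.
    cut-∷ : ∀ {i j l} → i ≢ j → i ≢ l → j ≢ l → Cut i W →
      Cut i (v ∷ W) ⊎ Cut j (v ∷ W) ⊎ Cut l (v ∷ W)
    cut-∷ {i} {j} {l} i≢j i≢l j≢l cut
      with cut⊎edge i (λ z → D z × z ≢ v) (λ z → D? z ×-dec ¬? (z ≟ v))
             (there inside∈) (D-inside , v∉ inside∈) (there outside∈) (¬D-outside ∘ proj₁)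
         | cut⊎edge i (λ z → D z ⊎ z ≡ v) (λ z → D? z ⊎-dec (z ≟ v))
             (there inside∈) (inj₁ D-inside) (there outside∈) [ ¬D-outside , v∉ outside∈ ]′
         | cut⊎edge j (_≡ v) (_≟ v) (here refl) refl (there inside∈) (v∉ inside∈)
         | cut⊎edge l (_≡ v) (_≟ v) (here refl) refl (there inside∈) (v∉ inside∈)
      where open Cut cut
    ... | inj₁ c | _ | _ | _ = inj₁ c
    ... | inj₂ _ | inj₁ c | _ | _ = inj₁ c
    ... | inj₂ _ | inj₂ _ | inj₁ c | _ = inj₂ (inj₁ c)
    ... | inj₂ _ | inj₂ _ | inj₂ _ | inj₁ c = inj₂ (inj₂ c)
    ... | inj₂ (p , q , p∈ , q∈ , (Dp , p≢v) , ¬q , pq)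
        | inj₂ (p′ , q′ , p′∈ , q′∈ , p′S , ¬q′ , pq′)
        | inj₂ (_ , x , _ , x∈ , refl , x≢v , vx)
        | inj₂ (_ , x′ , _ , x′∈ , refl , x′≢v , vx′) = inj₁ result
      where
      open Cut cut
      ∈W : ∀ {x} → x ∈ v ∷ W → x ≢ v → x ∈ W
      ∈W x∈ x≢v with split x∈
      ... | inj₁ eq = contradiction eq x≢v
      ... | inj₂ x∈ = x∈
      vp : χ v p ≡ i
      vp with split q∈
      ... | inj₁ refl = trans (χ-sym v p) pq
      ... | inj₂ q∈W  = contradiction pq (closed (∈W p∈ p≢v) q∈W Dp (λ Dq → ¬q (Dq , v∉ q∈W)))
      q′≢v : q′ ≢ v
      q′≢v = ¬q′ ∘ inj₂
      vq′ : χ v q′ ≡ i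
      vq′ = [ (λ Dp′ → [ at-v , (λ p′∈W → contradiction pq′ (closed p′∈W (∈W q′∈ q′≢v) Dp′ (¬q′ ∘ inj₁))) ]′ (split p′∈))
            , at-v ]′ p′S
        where
        at-v : p′ ≡ v → χ v q′ ≡ i
        at-v eq = trans (cong (λ z → χ z q′) (sym eq)) pq′
      result : Cut i (v ∷ W)
      result with D? x | D? x′
      ... | yes Dx | no  ¬Dx′ = separated i≢j i≢l j≢l D? closed (∈W x∈ x≢v) Dx vx (∈W x′∈ x′≢v) ¬Dx′ vx′
      ... | no ¬Dx | yes Dx′  = separated i≢l i≢j (≢-sym j≢l) D? closed (∈W x′∈ x′≢v) Dx′ vx′ (∈W x∈ x≢v) ¬Dx vx
      ... | yes Dx | yes Dx′  = together i≢j i≢l j≢l D? closed (∈W x∈ x≢v) Dx vx (∈W x′∈ x′≢v) Dx′ vx′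
                                  (∈W q′∈ q′≢v) (¬q′ ∘ inj₁) vq′
      ... | no ¬Dx | no  ¬Dx′ = together i≢j i≢l j≢l (¬? ∘ D?) (closed-∁ D? closed) (∈W x∈ x≢v) ¬Dx vx (∈W x′∈ x′≢v) ¬Dx′ vx′
                                  (∈W p∈ p≢v) (λ ¬Dp → ¬Dp Dp) vp

  -- Vertices are added one at a time. The single edge on two vertices misses `i` or `j`, and
  -- `cut-∷` transfers a cut to one more vertex, possibly in another of the three colors.
  cut : ∀ {i j l W} → i ≢ j → i ≢ l → j ≢ l → Unique W → 2 ≤ length W →
    Cut i W ⊎ Cut j W ⊎ Cut l W
  cut {i} {j} {l} {a ∷ b ∷ []} i≢j i≢l j≢l ((a≢b ∷ []) ∷ _) _ with χ a b ≟ᶜ i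
  ... | no ab≢i = inj₁ (singleton ab≢i)
    where
    singleton : ∀ {c} → χ a b ≢ c → Cut c (a ∷ b ∷ [])
    singleton ab≢c = record
      { D? = _≟ a ; inside∈ = here refl ; D-inside = refl
      ; outside∈ = there (here refl) ; ¬D-outside = ≢-sym a≢b
      ; closed = λ { _ (here refl) refl a≢a → contradiction refl a≢a
                   ; _ (there (here refl)) refl _ → ab≢c } }
  ... | yes ab≡i = inj₂ (inj₁ record
      { D? = _≟ a ; inside∈ = here refl ; D-inside = refl
      ; outside∈ = there (here refl) ; ¬D-outside = ≢-sym a≢b
      ; closed = λ { _ (here refl) refl a≢a → contradiction refl a≢a
                   ; _ (there (here refl)) refl _ eq → i≢j (trans (sym ab≡i) eq) } })
  cut {W = _ ∷ []} _ _ _ _ (s≤s ())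
  cut {W = v ∷ W@(_ ∷ _ ∷ _)} i≢j i≢l j≢l v∷W!@(_ ∷ W!) _
    with cut i≢j i≢l j≢l W! (s≤s (s≤s z≤n))
  ... | inj₁ c = cut-∷ v∷W! i≢j i≢l j≢l c
  ... | inj₂ (inj₁ c) = [ inj₂ ∘ inj₁ , [ inj₁ , inj₂ ∘ inj₂ ]′ ]′ (cut-∷ v∷W! (≢-sym i≢j) j≢l i≢l c)
  ... | inj₂ (inj₂ c) = [ inj₂ ∘ inj₂ , [ inj₁ , inj₂ ∘ inj₁ ]′ ]′ (cut-∷ v∷W! (≢-sym i≢l) (≢-sym j≢l) i≢j c)

  record Module (r : V) (W : List V) : Set₁ where
    field
      M       : V → Set
      M?      : Decidable M
      root    : M r
      uniform : ∀ {z p q} → z ∈ W → ¬ M z → p ∈ W → M p → q ∈ W → M q → χ z p ≡ χ z q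

    members : List V
    members = filter M? W

    others : List V
    others = filter (¬? ∘ M?) W

  open Module

  singleton : ∀ r W → Module r W
  singleton r W = record { M = _≡ r ; M? = _≟ r ; root = refl ; uniform = λ { _ _ _ refl _ refl → refl } }

  -- If some z outside a closed set containing r is not uniform to it, then
  -- the part of the set that z sees like r is a smaller closed set.
  closed⇒module : ∀ n {c W D r} (D? : Decidable D) → length (filter D? W) ≤ n →
    Unique W → Closed c W D → r ∈ W → D r →
    ∃ λ (m : Module r W) → Closed c W (M m) × (∀ {x} → M m x → D x)
  closed⇒module zero D? len W! closed r∈ Dr =
    contradiction (≤-trans (∈⇒1≤length (∈-filter⁺ D? r∈ Dr)) len) λ ()
  closed⇒module (suc n) {c} {W} {D} {r} D? len W! closed r∈ Dr
    with Any.any? (λ z → ¬? (D? z) ×-dec Any.any? (λ p → D? p ×-dec ¬? (χ p z ≟ᶜ χ r z)) W) W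
  ... | yes found =
    let z , z∈ , ¬Dz , found′ = find found
        p , p∈ , Dp , pz≢rz   = find found′
        D′? = λ w → D? w ×-dec (χ w z ≟ᶜ χ r z)
        m , closed′ , M⊆D′ = closed⇒module n D′?
          (s≤s⁻¹ (≤-trans (length-filter-⊂ D′? D? proj₁ p∈ (pz≢rz ∘ proj₂) Dp) len))
          W! (closed-refine (χ r z) z∈ closed D? ¬Dz W!) r∈ (Dr , refl)
    in m , closed′ , proj₁ ∘ M⊆D′
  ... | no none = record { M? = D? ; root = Dr ; uniform = λ z∈ ¬Dz p∈ Dp q∈ Dq →
          trans (like-r z∈ ¬Dz p∈ Dp) (sym (like-r z∈ ¬Dz q∈ Dq)) } , closed , id
    where
    like-r : ∀ {z p} → z ∈ W → ¬ D z → p ∈ W → D p → χ z p ≡ χ z r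
    like-r {z} {p} z∈ ¬Dz p∈ Dp = trans (χ-sym z p) (trans
      (decidable-stable (χ p z ≟ᶜ χ r z) (λ neq → none (lose z∈ (¬Dz , lose p∈ (Dp , neq)))))
      (χ-sym r z))

  -- The module is taken inside the side of the cut containing `r`. It stays closed under `c`, so it
  -- keeps the neighbor `x`, and it misses the witness on the opposite side.
  cut⇒module : ∀ {c W r x} → Unique W → Cut c W → r ∈ W → x ∈ W → χ r x ≡ c →
    ∃ λ (m : Module r W) → M m x × (∃[ y ] y ∈ W × ¬ M m y)
  cut⇒module {r = r} {x} W! cut r∈ x∈ rx≡c with Cut.D? cut r
  ... | yes Dr =
    let m , closed′ , M⊆D = closed⇒module _ D? ≤-refl W! closed r∈ Dr
    in m , decidable-stable (M? m x) (λ ¬Mx → closed′ r∈ x∈ (root m) ¬Mx rx≡c) ,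
       outside , outside∈ , ¬D-outside ∘ M⊆D
    where open Cut cut
  ... | no ¬Dr =
    let m , closed′ , M⊆∁D = closed⇒module _ (¬? ∘ D?) ≤-refl W! (closed-∁ D? closed) r∈ ¬Dr
    in m , decidable-stable (M? m x) (λ ¬Mx → closed′ r∈ x∈ (root m) ¬Mx rx≡c) ,
       inside , inside∈ , λ Mi → M⊆∁D Mi D-inside
    where open Cut cut

  ∷-others-unique : ∀ {r W} → Unique W → (m : Module r W) → Unique (r ∷ others m)
  ∷-others-unique {W = W} W! m =
    All.tabulate (λ { z∈ refl → proj₂ (∈-filter⁻ (¬? ∘ M? m) {xs = W} z∈) (root m) })
    ∷ Unique.filter⁺ (¬? ∘ M? m) W!

  -- Contracting the module to `r` leaves the list `r ∷ others m`, in which `r` still sees three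
  -- colors. A cut there gives a proper module containing `r` and a further vertex; its union with
  -- the old module is again a proper module of `W`.
  grow : ∀ {r W x y o} → Unique W → r ∈ W → (m : Module r W) →
    x ∈ others m → y ∈ others m → o ∈ others m →
    χ r x ≢ χ r y → χ r x ≢ χ r o → χ r y ≢ χ r o →
    ∃ λ (m′ : Module r W) → length (members m) < length (members m′) ×
      (∃[ z ] z ∈ W × ¬ M m′ z)
  grow {r} {W} {x} {y} {o} W! r∈ m x∈ y∈ o∈ x≢y x≢o y≢o =
    [ enlarge x∈ , [ enlarge y∈ , enlarge o∈ ]′ ]′
        (cut x≢y x≢o y≢o (∷-others-unique W! m) (s≤s (∈⇒1≤length x∈)))
    where
    enlarge : ∀ {x} → x ∈ others m → Cut (χ r x) (r ∷ others m) →
      ∃ λ (m′ : Module r W) → length (members m) < length (members m′) ×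
        (∃[ z ] z ∈ W × ¬ M m′ z)
    enlarge {x} x∈ c
      with x∈W , ¬Mx ← ∈-filter⁻ (¬? ∘ M? m) {xs = W} x∈
      with m₁ , M₁x , z , z∈ , ¬M₁z ← cut⇒module (∷-others-unique W! m) c (here refl) (there x∈) refl =
      m′ , length-filter-⊂ (M? m) (M? m′) inj₁ x∈W ¬Mx (inj₂ M₁x) , z , z∈W z∈ , ¬Mz∪ z∈
      where
      new : ∀ {z} → z ∈ W → ¬ M m z → z ∈ r ∷ others m
      new z∈ ¬Mz = there (∈-filter⁺ (¬? ∘ M? m) z∈ ¬Mz)
      like-r : ∀ {z p} → z ∈ W → ¬ (M m z ⊎ M m₁ z) → p ∈ W → M m p ⊎ M m₁ p → χ z p ≡ χ z r
      like-r z∈ ¬z p∈ (inj₁ Mp) = uniform m z∈ (¬z ∘ inj₁) p∈ Mp r∈ (root m)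
      like-r {p = p} z∈ ¬z p∈ (inj₂ M₁p) with M? m p
      ... | yes Mp = uniform m z∈ (¬z ∘ inj₁) p∈ Mp r∈ (root m)
      ... | no ¬Mp = uniform m₁ (new z∈ (¬z ∘ inj₁)) (¬z ∘ inj₂) (new p∈ ¬Mp) M₁p (here refl) (root m₁)
      m′ : Module r W
      m′ = record
        { M = λ z → M m z ⊎ M m₁ z ; M? = λ z → M? m z ⊎-dec M? m₁ z ; root = inj₁ (root m)
        ; uniform = λ z∈ ¬z p∈ p q∈ q → trans (like-r z∈ ¬z p∈ p) (sym (like-r z∈ ¬z q∈ q)) }
      z∈W : z ∈ r ∷ others m → z ∈ W
      z∈W (here refl) = r∈
      z∈W (there z∈)  = proj₁ (∈-filter⁻ (¬? ∘ M? m) {xs = W} z∈)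
      ¬Mz∪ : z ∈ r ∷ others m → ¬ (M m z ⊎ M m₁ z)
      ¬Mz∪ _           (inj₂ M₁z) = ¬M₁z M₁z
      ¬Mz∪ (here refl) (inj₁ _)   = ¬M₁z (root m₁)
      ¬Mz∪ (there z∈)  (inj₁ Mz)  = proj₂ (∈-filter⁻ (¬? ∘ M? m) {xs = W} z∈) Mz

  TwoColored : V → C → List V → Set
  TwoColored r κ O = ∀ {x y} → x ∈ O → y ∈ O → χ r x ≢ κ → χ r y ≢ κ → χ r x ≡ χ r y

  twoColored⊎ : ∀ r κ O → TwoColored r κ O ⊎
    (∃₂ λ x y → x ∈ O × y ∈ O × χ r x ≢ χ r y × χ r x ≢ κ × χ r y ≢ κ)
  twoColored⊎ r κ O
    with Any.any? (λ x → Any.any? (λ y → ¬? (χ r x ≟ᶜ χ r y) ×-dec ¬? (χ r x ≟ᶜ κ) ×-dec ¬? (χ r y ≟ᶜ κ)) O) O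
  ... | yes found = inj₂ (let x , x∈ , found′ = find found
                              y , y∈ , distinct = find found′
                          in x , y , x∈ , y∈ , distinct)
  ... | no none = inj₁ λ {x} {y} x∈ y∈ x≢κ y≢κ → decidable-stable (χ r x ≟ᶜ χ r y)
                    λ x≢y → none (lose x∈ (lose y∈ (x≢y , x≢κ , y≢κ)))

  -- The fuel `n` bounds the members still missing, as every `grow` adds at least one. The color
  -- from `r` to the outside vertex `z` serves as reference color, so a failure of `TwoColored`
  -- yields the three colors that `grow` needs.
  growUntil : ∀ n s {r W} → Unique W → r ∈ W → (m : Module r W) → (∃[ z ] z ∈ W × ¬ M m z) →
    s ≤ n + length (members m) →
    ∃ λ (m′ : Module r W) → (∃[ z ] z ∈ W × ¬ M m′ z) × length (members m) ≤ length (members m′) ×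
      (s ≤ length (members m′) ⊎ length (members m′) < s × (∃[ κ ] TwoColored r κ (others m′)))
  growUntil zero s W! r∈ m proper big = m , proper , ≤-refl , inj₁ big
  growUntil (suc n) s {r} {W} W! r∈ m (z , z∈ , ¬Mz) big with s ≤? length (members m)
  ... | yes s≤ = m , (z , z∈ , ¬Mz) , ≤-refl , inj₁ s≤
  ... | no  s≰ with twoColored⊎ r (χ r z) (others m)
  ...   | inj₁ two = m , (z , z∈ , ¬Mz) , ≤-refl , inj₂ (≰⇒> s≰ , χ r z , two)
  ...   | inj₂ (x , y , x∈ , y∈ , x≢y , x≢z , y≢z) =
    let m₁ , larger , proper₁ = grow W! r∈ m x∈ y∈ (∈-filter⁺ (¬? ∘ M? m) z∈ ¬Mz) x≢y x≢z y≢z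
        m₂ , proper₂ , larger₂ , result = growUntil n s W! r∈ m₁ proper₁
          (≤-trans big (≤-trans (≤-reflexive (sym (+-suc n _))) (+-monoʳ-≤ n larger)))
    in m₂ , proper₂ , ≤-trans (<⇒≤ larger) larger₂ , result

-- Bounds on the number of vertices

n<2^n : ∀ n → suc n ≤ 2 ^ n
n<2^n zero    = ≤-refl
n<2^n (suc n) = ≤-by n (*-monoʳ-≤ 2 (n<2^n n)) (eq n (2 ^ n))
  where
  eq : ∀ n x → suc (suc n) + 2 * x + n ≡ 2 * x + 2 * suc n
  eq = solve-∀

2+n≤2^n : ∀ z → 4 + z ≤ 2 ^ (2 + z)
2+n≤2^n zero    = ≤-refl
2+n≤2^n (suc z) = ≤-by (3 + z) (*-monoʳ-≤ 2 (2+n≤2^n z)) (eq z (2 ^ (2 + z)))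
  where
  eq : ∀ z x → 4 + suc z + 2 * x + (3 + z) ≡ 2 * x + 2 * (4 + z)
  eq = solve-∀

rising<2^ : ∀ r → (1 + r) * (2 + r) * (3 + r) + 1 ≤ 24 * 2 ^ r
rising<2^ 0 = m≤m+n 7 17
rising<2^ 1 = m≤m+n 25 23
rising<2^ 2 = m≤m+n 61 35
rising<2^ (suc r@(suc (suc z))) =
  ≤-by ((4 + z) * (5 + z) * z + 1) (*-monoʳ-≤ 2 (rising<2^ r)) (eq z (2 ^ r))
  where
  eq : ∀ z x → (4 + z) * (5 + z) * (6 + z) + 1 + 2 * (24 * x) + ((4 + z) * (5 + z) * z + 1) ≡
       24 * (2 * x) + 2 * ((3 + z) * (4 + z) * (5 + z) + 1)
  eq = solve-∀

-- Each vertex dropped from the t-side lowers the required number by 2^s/(s+1), which is at least 1.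
Suffices-shrink : ∀ s τ x w → Suffices s (τ + x) (w + x) → Suffices s τ w
Suffices-shrink s τ x w (suffices c) = suffices (≤-by 0
  (+-mono-≤ c (*-monoʳ-≤ (6 * x) (n<2^n s))) (eq s τ x w (2 ^ s) (suc s * s * (s + 5)) (δ s)))
  where
  eq : ∀ s τ x w X B d → 6 * X * τ + B + d + (6 * suc s * (w + x) + 6 * x * X) + 0 ≡
       6 * suc s * w + (6 * X * (τ + x) + B + d + 6 * x * suc s)
  eq = solve-∀

-- Here w = 2 + z is the size of the module, 2 + r the number of vertices still
-- missing on the s-side, and x = 2^w - w - 2.  The inequality is multiplied by
-- 4(r + z + 5) to clear the denominators.
Suffices-module : ∀ r z τ n u → 2 ≤ τ → n ≤ 2 * u + (2 + z) →
  Suffices (2 + r + (2 + z)) τ n → Suffices (2 + r) τ u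
Suffices-module r z τ n u 2≤τ n≤ (suffices c) with m≤n⇒∃[o]m+o≡n (2+n≤2^n z)
... | x , eqX = suffices (≤-trans (+-monoʳ-≤ _ (δ≤1 (2 + r))) (≤-trans (≤-reflexive (shape (2 ^ (2 + r)) τ r)) goal))
  where
  T = 2 ^ (2 + r) * τ
  shape : ∀ X τ r → 6 * X * τ + (3 + r) * (2 + r) * (2 + r + 5) + 1 ≡ suc (6 * (X * τ) + (3 + r) * (2 + r) * (7 + r))
  shape = solve-∀
  c′ : 6 * (T * (4 + z + x)) + (5 + r + z) * (4 + r + z) * (9 + r + z) ≤ 6 * (5 + r + z) * n
  c′ = ≤-trans (≤-reflexive (trans (shape′ (2 ^ (2 + r)) (4 + z + x) τ r z)
         (cong (λ y → 6 * y * τ + suc (2 + r + (2 + z)) * (2 + r + (2 + z)) * (2 + r + (2 + z) + 5))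
           (sym (trans (^-distribˡ-+-* 2 (2 + r) (2 + z)) (cong (2 ^ (2 + r) *_) (sym eqX)))))))
       (≤-trans (m≤m+n _ _) (≤-trans c (≤-reflexive (cong (λ b → 6 * suc b * n) (size r z)))))
    where
    shape′ : ∀ X Y τ r z → 6 * (X * τ * Y) + (5 + r + z) * (4 + r + z) * (9 + r + z) ≡
      6 * (X * Y) * τ + suc (2 + r + (2 + z)) * (2 + r + (2 + z)) * (2 + r + (2 + z) + 5)
    shape′ = solve-∀
    size : ∀ r z → 2 + r + (2 + z) ≡ 4 + r + z
    size = solve-∀
  -- Comparing the terms in `T` leaves a surplus of `12 * T * ((2 + z) * (1 + r))`. Through `H`,
  -- which relies on `2 ≤ τ`, it pays for the polynomial terms.
  H : (3 + r) * (4 + r) * (5 + r) + 1 ≤ 12 * T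
  H = ≤-trans (rising<2^ (2 + r)) (≤-trans (≤-reflexive (double (2 ^ (2 + r))))
        (*-monoʳ-≤ 12 (*-monoʳ-≤ (2 ^ (2 + r)) 2≤τ)))
    where
    double : ∀ x → 24 * x ≡ 12 * (x * 2)
    double = solve-∀
  eq : ∀ r z T x u n →
    suc (4 * (5 + r + z) * (6 * T + (3 + r) * (2 + r) * (7 + r))) +
    (2 * (3 + r) * (6 * (5 + r + z) * n) + 12 * (3 + r) * (5 + r + z) * (2 * u + (2 + z)) + 12 * T * ((2 + z) * (1 + r))) +
    (12 * T * (3 + r) * x + 2 * (5 + r + z) * (3 + r) * (2 * (2 + r) * z + 3 * z + z * z)
        + (3 + r) * (3 + r) * (4 + r) * (1 + r) * z + (1 + z + 2 * r + z * r))
    ≡ 4 * (5 + r + z) * (6 * (3 + r) * u) +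
    (2 * (3 + r) * (6 * (T * (4 + z + x)) + (5 + r + z) * (4 + r + z) * (9 + r + z)) + 12 * (3 + r) * (5 + r + z) * n +
      ((3 + r) * (4 + r) * (5 + r) + 1) * ((2 + z) * (1 + r)))
  eq = solve-∀
  goal : 6 * T + (3 + r) * (2 + r) * (7 + r) < 6 * (3 + r) * u
  goal = *-cancelˡ-< (4 * (5 + r + z)) _ _ (≤-by
    (12 * T * (3 + r) * x + 2 * (5 + r + z) * (3 + r) * (2 * (2 + r) * z + 3 * z + z * z)
      + (3 + r) * (3 + r) * (4 + r) * (1 + r) * z + (1 + z + 2 * r + z * r))
    (+-mono-≤ (+-mono-≤ (*-monoʳ-≤ (2 * (3 + r)) c′) (*-monoʳ-≤ (12 * (3 + r) * (5 + r + z)) n≤))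
              (*-monoˡ-≤ ((2 + z) * (1 + r)) H))
    (eq r z T x u n))

-- For s ≥ 3 both 2^s ≥ 2(s+1) and s(s+5)/6 ≥ s hold.
Suffices⇒size : ∀ z τ n → Suffices (3 + z) τ n → 2 * τ + (3 + z) ≤ n
Suffices⇒size z τ n (suffices c) with m≤n⇒∃[o]m+o≡n (2+n≤2^n z)
... | x , eqX = *-cancelˡ-≤ (6 * (4 + z))
  (≤-by (12 * x * τ + z * (3 + z) * (4 + z) + 2 * (3 + z) * (4 + z)) c′ (eq z τ x n))
  where
  c′ : 6 * (2 * (4 + z + x)) * τ + (4 + z) * (3 + z) * (3 + z + 5) ≤ 6 * (4 + z) * n
  c′ = subst (λ y → 6 * (2 * y) * τ + (4 + z) * (3 + z) * (3 + z + 5) ≤ 6 * (4 + z) * n) (sym eqX)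
         (≤-trans (m≤m+n _ _) c)
  eq : ∀ z τ x n → 6 * (4 + z) * (2 * τ + (3 + z)) + 6 * (4 + z) * n +
         (12 * x * τ + z * (3 + z) * (4 + z) + 2 * (3 + z) * (4 + z)) ≡
       6 * (4 + z) * n + (6 * (2 * (4 + z + x)) * τ + (4 + z) * (3 + z) * (3 + z + 5))
  eq = solve-∀

-- Allows t = 2 to be handled with the sides exchanged: for s ≥ 3 the number required for (s, 2) is
-- large enough for (2, s), including the strictness demanded by `δ 2`.
Suffices-swap : ∀ z n → Suffices (3 + z) 1 n → Suffices 2 (2 + z) n
Suffices-swap z n (suffices c) with m≤n⇒∃[o]m+o≡n (2+n≤2^n z)
... | x , eqX = suffices (*-cancelˡ-≤ (4 + z) (≤-by (36 * x + 3 * (z * (3 + z) * (4 + z)) + 17 * (4 + z))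
    (*-monoʳ-≤ 3 c′) (eq z x n)))
  where
  c′ : 6 * (2 * (4 + z + x)) * 1 + (4 + z) * (3 + z) * (3 + z + 5) ≤ 6 * (4 + z) * n
  c′ = subst (λ y → 6 * (2 * y) * 1 + (4 + z) * (3 + z) * (3 + z + 5) ≤ 6 * (4 + z) * n) (sym eqX)
         (≤-trans (m≤m+n _ _) c)
  eq : ∀ z x n → (4 + z) * (24 * (2 + z) + 42 + 1) + 3 * (6 * (4 + z) * n) +
         (36 * x + 3 * (z * (3 + z) * (4 + z)) + 17 * (4 + z)) ≡
       (4 + z) * (18 * n) + 3 * (6 * (2 * (4 + z + x)) * 1 + (4 + z) * (3 + z) * (3 + z + 5))
  eq = solve-∀

-- Orderable complete bipartite graphs

Unique-resp-↭ : ∀ {A : Set} {xs ys : List A} → xs ↭ ys → Unique xs → Unique ys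
Unique-resp-↭ {A} xs↭ys = Permutation.Unique-resp-↭ (setoid A) (↭⇒↭ₛ xs↭ys)

filter-++-∁-↭ : ∀ {A : Set} {P : A → Set} (P? : Decidable P) xs →
  filter P? xs ++ filter (¬? ∘ P?) xs ↭ xs
filter-++-∁-↭ P? []       = ↭-refl
filter-++-∁-↭ P? (x ∷ xs) with P? x
... | yes _ = prep x (filter-++-∁-↭ P? xs)
... | no  _ = ↭-trans (shift x (filter P? xs) _) (prep x (filter-++-∁-↭ P? xs))

∉-++ˡ : ∀ {A : Set} (xs : List A) {y ys} → Unique (xs ++ y ∷ ys) → y ∉ xs
∉-++ˡ (x ∷ xs) (x∉ ∷ _)    (here refl) = All.lookup (All.++⁻ʳ xs x∉) (here refl) refl
∉-++ˡ (x ∷ xs) (_ ∷ u)     (there y∈)  = ∉-++ˡ xs u y∈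

length-take-≤ : ∀ {A : Set} n (xs : List A) → n ≤ length xs → length (take n xs) ≡ n
length-take-≤ n xs n≤ = trans (length-take n xs) (m≤n⇒m⊓n≡m n≤)

∈-take⁻ : ∀ {A : Set} n {xs : List A} {x} → x ∈ take n xs → x ∈ xs
∈-take⁻ n x∈ = All.lookup (All.take⁺ n (All.tabulate id)) x∈

-- The additional vertex need not satisfy `P`: it is whatever comes first once `t` vertices with `P`
-- have been taken out of `O`.
spare : ∀ {A : Set} {P : A → Set} (P? : Decidable P) t {O} → Unique O →
  t ≤ length (filter P? O) → t < length O →
  ∃₂ λ a bs → a ∈ O × a ∉ bs × length bs ≡ t × Unique bs × All (λ b → b ∈ O × P b) bs
spare {A} {P} P? t {O} O! t≤ t< = choose rest split
  where
  bs rest : List A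
  bs = take t (filter P? O)
  rest = drop t (filter P? O) ++ filter (¬? ∘ P?) O
  split : bs ++ rest ↭ O
  split = subst (_↭ O)
    (trans (cong (_++ filter (¬? ∘ P?) O) (sym (take++drop≡id t (filter P? O)))) (++-assoc bs _ _))
    (filter-++-∁-↭ P? O)
  length-bs : length bs ≡ t
  length-bs = length-take-≤ t (filter P? O) t≤
  choose : ∀ xs → bs ++ xs ↭ O →
    ∃₂ λ a bs → a ∈ O × a ∉ bs × length bs ≡ t × Unique bs × All (λ b → b ∈ O × P b) bs
  choose []       bs↭O = contradiction t< (<-irrefl
    (trans (sym length-bs) (trans (cong length (sym (++-identityʳ bs))) (↭-length bs↭O))))
  choose (a ∷ xs) bs↭O =
    a , bs , ∈-resp-↭ bs↭O (∈-++⁺ʳ bs (here refl)) , ∉-++ˡ bs (Unique-resp-↭ (↭-sym bs↭O) O!) ,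
    length-bs , Unique.take⁺ t (Unique.filter⁺ P? O!) ,
    All.tabulate (∈-filter⁻ P? {xs = O} ∘ ∈-take⁻ t)

∧-true : ∀ {x y} → x ∧ y ≡ true → x ≡ true × y ≡ true
∧-true {true} {true} _ = refl , refl

∨-true : ∀ {x y} → x ∨ y ≡ true → x ≡ true ⊎ y ≡ true
∨-true {true}  _ = inj₁ refl
∨-true {false} p = inj₂ p

all-true : ∀ {A : Set} (p : A → Bool) xs → all p xs ≡ true → All (λ x → p x ≡ true) xs
all-true p []       _  = []
all-true p (x ∷ xs) eq = let px , pxs = ∧-true {p x} eq in px ∷ all-true p xs pxs

count≡length-filter : ∀ {A : Set} (p : A → Bool) xs → count p xs ≡ length (filter (λ x → p x Bool.≟ true) xs)
count≡length-filter p []       = refl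
count≡length-filter p (x ∷ xs) with p x
... | true  = cong suc (count≡length-filter p xs)
... | false = count≡length-filter p xs

module Words {V C : Set} (χ : V → V → C) where

  Mono : V → List V → Set
  Mono u vs = ∃ λ c → All (λ v → χ u v ≡ c) vs

  -- An ordering of as ∪ bs, read from the outside in, witnessing that the
  -- complete bipartite graph between as and bs is orderable.
  data Word : List V → List V → Set where
    []   : Word [] []
    _∷ˡ_ : ∀ {a as bs} → Mono a bs → Word as bs → Word (a ∷ as) bs
    _∷ʳ_ : ∀ {b as bs} → Mono b as → Word as bs → Word as (b ∷ bs)

  flip : ∀ {as bs} → Word as bs → Word bs as
  flip []       = []
  flip (m ∷ˡ w) = m ∷ʳ flip w
  flip (m ∷ʳ w) = m ∷ˡ flip w

  _++ˡ_ : ∀ {as as′ bs} → All (λ a → Mono a bs) as′ → Word as bs → Word (as′ ++ as) bs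
  []       ++ˡ w = w
  (m ∷ ms) ++ˡ w = m ∷ˡ (ms ++ˡ w)

  _++ʳ_ : ∀ {as bs bs′} → All (λ b → Mono b as) bs′ → Word as bs → Word as (bs′ ++ bs)
  []       ++ʳ w = w
  (m ∷ ms) ++ʳ w = m ∷ʳ (ms ++ʳ w)

  independent : ∀ as → Word as []
  independent []       = []
  independent (a ∷ as) = mono₀ ∷ˡ independent as
    where
    mono₀ : Mono a []
    -- Any color would do; `χ a a` is a default.
    mono₀ = χ a a , []

  independent′ : ∀ bs → Word [] bs
  independent′ bs = flip (independent bs)

  record Orderable-K (W : List V) (s t : ℕ) : Set where
    field
      {as bs}   : List V
      word      : Word as bs
      length-as : length as ≡ s
      length-bs : length bs ≡ t
      as∈       : All (_∈ W) as
      bs∈       : All (_∈ W) bs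
      as!       : Unique as
      bs!       : Unique bs
      disjoint  : Disjoint as bs

  transpose : ∀ {W s t} → Orderable-K W s t → Orderable-K W t s
  transpose k = record
    { word = flip word ; length-as = length-bs ; length-bs = length-as ; as∈ = bs∈ ; bs∈ = as∈
    ; as! = bs! ; bs! = as! ; disjoint = λ (x∈bs , x∈as) → disjoint (x∈as , x∈bs) }
    where open Orderable-K k

-- Colorings with at most two colors at each vertex

module LocallyTwoColored {V C : Set} (_≟_ : DecidableEquality V) (_≟ᶜ_ : DecidableEquality C)
  (χ : V → V → C) where

  open Words χ

  TwoColoredAt : (V → C) → List V → V → Set
  TwoColoredAt κ W u = ∀ {x y} → x ∈ W → y ∈ W → x ≢ u → y ≢ u → χ u x ≢ κ u → χ u y ≢ κ u → χ u x ≡ χ u y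

  module _ (κ : V → C) {W : List V} (two : ∀ {u} → u ∈ W → TwoColoredAt κ W u) where

    open Cover _≟_ (λ u v → does (χ u v ≟ᶜ κ u))

    -- The bit `true` stands for the color `κ u`, the bit `false` for the common value of all other
    -- colors at `u`, which `two` guarantees.
    bit⇒mono : ∀ {u} c {vs} → u ∈ W → All (λ v → v ∈ W × v ≢ u × hit c (does (χ u v ≟ᶜ κ u)) ≡ true) vs → Mono u vs
    bit⇒mono {u} true u∈ vs = κ u , All.map (λ (_ , _ , eq) → agrees eq) vs
      where
      agrees : ∀ {v} → does (χ u v ≟ᶜ κ u) ≡ true → χ u v ≡ κ u
      agrees {v} eq with yes p ← χ u v ≟ᶜ κ u = p
    bit⇒mono {u} false u∈ [] = κ u , []
    bit⇒mono {u} false u∈ (_∷_ {x = v₀} p₀@(v₀∈ , v₀≢ , eq₀) vs) =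
      χ u v₀ , All.map (λ (v∈ , v≢ , eq) → two u∈ v∈ v₀∈ v≢ v₀≢ (differs eq) (differs eq₀)) (p₀ ∷ vs)
      where
      differs : ∀ {v} → not (does (χ u v ≟ᶜ κ u)) ≡ true → χ u v ≢ κ u
      differs {v} eq with no p ← χ u v ≟ᶜ κ u = p

    other⇒≢ : ∀ {v a} → other v a ≡ true → a ≢ v
    other⇒≢ {v} {a} eq with no a≢v ← a ≟ v = a≢v

    all-same⇒ : ∀ c {v} as → all (same c v) as ≡ true →
      All (λ a → a ≢ v × hit c (does (χ v a ≟ᶜ κ v)) ≡ true) as
    all-same⇒ c {v} as eq = All.map
      (λ {a} e → let o , h = ∧-true {other v a} e in other⇒≢ o , h) (all-true (same c v) as eq)

    Uniform : V → List V → Set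
    Uniform v as = all (same true v) as ≡ true ⊎ all (same false v) as ≡ true

    covers-∷ : ∀ {v a c} as cs → covers v (a ∷ as) (c ∷ cs) ≡ true →
      (other v a ≡ true × hit c (does (χ a v ≟ᶜ κ a)) ≡ true × covers v as cs ≡ true) ⊎
      Uniform v (a ∷ as)
    covers-∷ {v} {a} {c} as cs eq
      with ∨-true {other v a ∧ hit c (does (χ a v ≟ᶜ κ a)) ∧ covers v as cs} eq
    ... | inj₂ e = inj₂ (∨-true {all (same true v) (a ∷ as)} e)
    ... | inj₁ e = inj₁ (map₂ (∧-true {hit c (does (χ a v ≟ᶜ κ a))}) (∧-true {other v a} e))

    uniform⇒ : ∀ {v} as → Uniform v as →
      ∃ λ c → All (λ a → a ≢ v × hit c (does (χ v a ≟ᶜ κ v)) ≡ true) as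
    uniform⇒ as (inj₁ e) = true , all-same⇒ true as e
    uniform⇒ as (inj₂ e) = false , all-same⇒ false as e

    covers⇒∉ : ∀ {v} as cs → covers v as cs ≡ true → v ∉ as
    covers⇒∉ {v} (a ∷ as) (c ∷ cs) eq v∈ with covers-∷ {v} {a} {c} as cs eq | v∈
    ... | inj₂ u           | _           = proj₁ (All.lookup (proj₂ (uniform⇒ (a ∷ as) u)) v∈) refl
    ... | inj₁ (o , _ , _) | here v≡a    = other⇒≢ o (sym v≡a)
    ... | inj₁ (_ , _ , e) | there v∈as  = covers⇒∉ as cs e v∈as

    -- Vertices that see all of `a ∷ as` in one color are placed before `a`. The others can be
    -- covered only by agreeing with the bit of `a`, so `a` sees all of them in one color and they
    -- are passed on to `as`. This reorders `bs`.
    covers⇒word : ∀ as cs bs → All (_∈ W) as → All (λ v → v ∈ W × covers v as cs ≡ true) bs →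
      ∃ λ bs′ → Word as bs′ × bs′ ↭ bs
    covers⇒word []       cs bs _ _ = bs , independent′ bs , ↭-refl
    covers⇒word (a ∷ as) []       []      _ _ = [] , independent (a ∷ as) , ↭-refl
    covers⇒word (a ∷ as) []       (b ∷ bs) _ ((_ , ()) ∷ _)
    covers⇒word (a ∷ as) (c ∷ cs) bs (a∈ ∷ as∈) covered =
      let rest′ , word , rest′↭rest = covers⇒word as cs rest as∈
            (All.map (λ (v∈ , o , h , cov) → v∈ , cov) restOK)
          mono-a = bit⇒mono c a∈ (All-resp-↭ (↭-sym rest′↭rest)
            (All.map (λ (v∈ , a≢v , h , cov) → v∈ , ≢-sym a≢v , h) restOK))
      in early ++ rest′ , earlyOK ++ʳ (mono-a ∷ˡ word) ,
         ↭-trans (++⁺ˡ early rest′↭rest) (filter-++-∁-↭ early? bs)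
      where
      early? : Decidable (λ v → Uniform v (a ∷ as))
      early? v = (all (same true v) (a ∷ as) Bool.≟ true) ⊎-dec (all (same false v) (a ∷ as) Bool.≟ true)
      early = filter early? bs
      rest = filter (¬? ∘ early?) bs
      restOK : All (λ v → v ∈ W × a ≢ v × hit c (does (χ a v ≟ᶜ κ a)) ≡ true × covers v as cs ≡ true) rest
      restOK = All.tabulate λ {v} v∈ → matched v (∈-filter⁻ (¬? ∘ early?) {xs = bs} v∈)
        where
        matched : ∀ v → v ∈ bs × ¬ Uniform v (a ∷ as) →
          v ∈ W × a ≢ v × hit c (does (χ a v ≟ᶜ κ a)) ≡ true × covers v as cs ≡ true
        matched v (v∈bs , late) with All.lookup covered v∈bs
        ... | v∈W , cov with covers-∷ {v} {a} {c} as cs cov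
        ...   | inj₁ (o , h , e) = v∈W , other⇒≢ o , h , e
        ...   | inj₂ u           = contradiction u late
      earlyOK : All (λ v → Mono v (a ∷ as)) early
      earlyOK = All.tabulate λ {v} v∈ →
        let v∈bs , u = ∈-filter⁻ early? {xs = bs} v∈
            c , sees = uniform⇒ (a ∷ as) u
        in bit⇒mono c (proj₁ (All.lookup covered v∈bs)) (All.zipWith id (a∈ ∷ as∈ , sees))

    covering⇒K : ∀ {s t as} cs → Unique W → length as ≡ s → All (_∈ W) as → Unique as →
      t ≤ count (λ v → covers v as cs) W → Orderable-K W s t
    covering⇒K {s} {t} {as} cs W! len as∈ as! t≤ = pack (covers⇒word as cs bs as∈ bsOK)
      where
      cov? : Decidable (λ v → covers v as cs ≡ true)
      cov? v = covers v as cs Bool.≟ true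
      bs : List V
      bs = take t (filter cov? W)
      bsOK : All (λ v → v ∈ W × covers v as cs ≡ true) bs
      bsOK = All.tabulate (∈-filter⁻ cov? {xs = W} ∘ ∈-take⁻ t)
      bs! : Unique bs
      bs! = Unique.take⁺ t (Unique.filter⁺ cov? W!)
      length-bs : length bs ≡ t
      length-bs = length-take-≤ t (filter cov? W)
        (≤-trans t≤ (≤-reflexive (count≡length-filter (λ v → covers v as cs) W)))
      pack : (∃ λ bs′ → Word as bs′ × bs′ ↭ bs) → Orderable-K W s t
      pack (bs′ , word , bs′↭bs) = record
        { word = word
        ; length-as = len
        ; length-bs = trans (↭-length bs′↭bs) length-bs
        ; as∈ = as∈
        ; bs∈ = All.map proj₁ bs′OK
        ; as! = as!
        ; bs! = Unique-resp-↭ (↭-sym bs′↭bs) bs!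
        ; disjoint = λ (x∈as , x∈bs′) → covers⇒∉ as cs (proj₂ (All.lookup bs′OK x∈bs′)) x∈as
        }
        where
        bs′OK : All (λ v → v ∈ W × covers v as cs ≡ true) bs′
        bs′OK = All-resp-↭ (↭-sym bs′↭bs) bsOK

    averaging⇒K : ∀ {s τ} → Unique W → Suffices (suc s) τ (length W) → Orderable-K W (suc s) (suc τ)
    averaging⇒K {s} {τ} W! cond = covering⇒K bits W! length-vertices vertices∈ unique holds
      where open Averaging.Sequence (averaging {s} {τ} W! cond)

-- The induction for colorings without rainbow triangles

module Main {V C : Set} (_≟_ : DecidableEquality V) (_≟ᶜ_ : DecidableEquality C)
  (χ : V → V → C) (χ-sym : ∀ u v → χ u v ≡ χ v u)
  (gallai : ∀ {x y z} → x ≢ y → y ≢ z → x ≢ z → χ x y ≢ χ y z →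
            χ x z ≡ χ x y ⊎ χ x z ≡ χ y z) where

  open Gallai _≟_ _≟ᶜ_ χ χ-sym gallai
  open Words χ
  open LocallyTwoColored _≟_ _≟ᶜ_ χ
  open Module

  star : ∀ {as bs} → All (λ b → Mono b as) bs → Word as bs
  star {as} {bs} monos = subst (Word as) (++-identityʳ bs) (monos ++ʳ independent as)

  module _ {r : V} {W : List V} (r∈ : r ∈ W) (m : Module r W) where

    ∈-members⁻ : ∀ {v} → v ∈ members m → v ∈ W × M m v
    ∈-members⁻ = ∈-filter⁻ (M? m) {xs = W}

    ∈-others⁻ : ∀ {v} → v ∈ others m → v ∈ W × ¬ M m v
    ∈-others⁻ = ∈-filter⁻ (¬? ∘ M? m) {xs = W}

    other-mono : ∀ {z as} → z ∈ others m → All (_∈ members m) as → Mono z as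
    other-mono {z} z∈ as∈ = χ z r , All.map
      (λ a∈ → let z∈W , ¬Mz = ∈-others⁻ z∈ ; a∈W , Ma = ∈-members⁻ a∈
              in uniform m z∈W ¬Mz a∈W Ma r∈ (root m)) as∈

    member-mono : ∀ {a us} → a ∈ members m → All (_∈ others m) us → Mono r us → Mono a us
    member-mono {a} a∈ us∈ (c , monos) = c , All.zipWith
      (λ {z} (z∈ , eq) →
        let z∈W , ¬Mz = ∈-others⁻ z∈ ; a∈W , Ma = ∈-members⁻ a∈
        in trans (χ-sym a z) (trans (uniform m z∈W ¬Mz a∈W Ma r∈ (root m)) (trans (χ-sym z r) eq)))
      (us∈ , monos)

    length-members+others : length (members m) + length (others m) ≡ length W
    length-members+others = length-filter-∁ (M? m) W

  Hypothesis : ℕ → Set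
  Hypothesis n = ∀ {W} s τ → length W < n → Unique W → Suffices (suc s) τ (length W) →
    Orderable-K W (suc s) (suc τ)

  large-module : ∀ {r W s τ} → Hypothesis (length W) → Unique W → r ∈ W → (m : Module r W) →
    (∃[ z ] z ∈ W × ¬ M m z) → suc s ≤ length (members m) → Suffices (suc s) τ (length W) →
    Orderable-K W (suc s) (suc τ)
  large-module {r} {W} {s} {τ} hyp W! r∈ m (z , z∈ , ¬Mz) s≤ cond with suc τ ≤? length (others m)
  ... | yes τ< = record
    { word = star (All.tabulate λ b∈ → other-mono r∈ m (∈-take⁻ (suc τ) b∈) (All.tabulate (∈-take⁻ (suc s))))
    ; length-as = length-take-≤ (suc s) (members m) s≤
    ; length-bs = length-take-≤ (suc τ) (others m) τ<
    ; as∈ = All.tabulate (proj₁ ∘ ∈-members⁻ r∈ m ∘ ∈-take⁻ (suc s))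
    ; bs∈ = All.tabulate (proj₁ ∘ ∈-others⁻ r∈ m ∘ ∈-take⁻ (suc τ))
    ; as! = Unique.take⁺ (suc s) (Unique.filter⁺ (M? m) W!)
    ; bs! = Unique.take⁺ (suc τ) (Unique.filter⁺ (¬? ∘ M? m) W!)
    ; disjoint = λ (x∈as , x∈bs) → proj₂ (∈-others⁻ r∈ m (∈-take⁻ (suc τ) x∈bs))
                                         (proj₂ (∈-members⁻ r∈ m (∈-take⁻ (suc s) x∈as)))
    }
  ... | no τ≮ with m≤n⇒∃[o]m+o≡n (≮⇒≥ τ≮)
  ...   | τ′ , x+τ′≡τ = record
    { word = All.tabulate (λ z∈ → other-mono r∈ m z∈ as∈) ++ʳ word
    ; length-as = length-as
    ; length-bs = trans (length-++ (others m))
        (trans (cong (length (others m) +_) length-bs) (trans (+-suc _ τ′) (cong suc x+τ′≡τ)))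
    ; as∈ = All.map (proj₁ ∘ ∈-members⁻ r∈ m) as∈
    ; bs∈ = All.++⁺ (All.tabulate (proj₁ ∘ ∈-others⁻ r∈ m)) (All.map (proj₁ ∘ ∈-members⁻ r∈ m) bs∈)
    ; as! = as!
    ; bs! = Unique.++⁺ (Unique.filter⁺ (¬? ∘ M? m) W!) bs!
        (λ (x∈o , x∈b) → proj₂ (∈-others⁻ r∈ m x∈o) (proj₂ (∈-members⁻ r∈ m (All.lookup bs∈ x∈b))))
    ; disjoint = λ (x∈as , x∈bs) →
        [ (λ x∈o → proj₂ (∈-others⁻ r∈ m x∈o) (proj₂ (∈-members⁻ r∈ m (All.lookup as∈ x∈as))))
        , (λ x∈b → disjoint (x∈as , x∈b)) ]′ (∈-++⁻ (others m) x∈bs)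
    }
    where
    smaller : length (members m) < length W
    smaller = ≤-trans (≤-reflexive (+-comm 1 _))
      (≤-trans (+-monoʳ-≤ (length (members m)) (∈⇒1≤length (∈-filter⁺ (¬? ∘ M? m) z∈ ¬Mz)))
               (≤-reflexive (length-members+others r∈ m)))
    cond′ : Suffices (suc s) τ′ (length (members m))
    cond′ = Suffices-shrink (suc s) τ′ (length (others m)) (length (members m))
      (subst₂ (Suffices (suc s)) (sym (trans (+-comm τ′ _) x+τ′≡τ)) (sym (length-members+others r∈ m)) cond)
    open Orderable-K (hyp s τ′ smaller (Unique.filter⁺ (M? m) W!) cond′)

  majority : ∀ {r κ O} → TwoColored r κ O →
    ∃ λ (P : V → Set) → ∃ λ (P? : Decidable P) →
      length O ≤ 2 * length (filter P? O) × Mono r (filter P? O)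
  majority {r} {κ} {O} two =
    [ (λ le → _ , κ? , half le (length-filter-∁ κ? O) , κ , All.all-filter κ? O)
    , (λ le → _ , ¬? ∘ κ? , half le (trans (+-comm (length (filter (¬? ∘ κ?) O)) _) (length-filter-∁ κ? O)) ,
              rest-mono (filter (¬? ∘ κ?) O) (All.tabulate (∈-filter⁻ (¬? ∘ κ?) {xs = O})))
    ]′ (≤-total (length (filter (¬? ∘ κ?) O)) (length (filter κ? O)))
    where
    κ? : Decidable (λ v → χ r v ≡ κ)
    κ? v = χ r v ≟ᶜ κ
    half : ∀ {a b n} → b ≤ a → a + b ≡ n → n ≤ 2 * a
    half {a} b≤a refl = +-monoʳ-≤ a (≤-trans b≤a (≤-reflexive (sym (+-identityʳ a))))
    rest-mono : ∀ us → All (λ u → u ∈ O × χ r u ≢ κ) us → Mono r us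
    rest-mono []       []               = κ , []
    rest-mono (u ∷ us) (p@(u∈ , u≢) ∷ ps) = χ r u , All.map (λ (v∈ , v≢) → two v∈ u∈ v≢ u≢) (p ∷ ps)

  prepend-module : ∀ {r W s τ} → Hypothesis (length W) → Unique W → r ∈ W → (m : Module r W) →
    ∀ {P : V → Set} (P? : Decidable P) → length (others m) ≤ 2 * length (filter P? (others m)) →
    Mono r (filter P? (others m)) → ∀ z → 2 + z ≡ length (members m) → 2 ≤ τ → Suffices (suc s) τ (length W) →
    ∀ d → suc (length (members m)) + d ≡ suc s → Orderable-K W (suc s) (suc τ)
  prepend-module {r} {W} {s} {τ} hyp W! r∈ m {P} P? O≤ mono-r z 2+z≡w 2≤τ cond = split
    where
    w = length (members m)
    O = others m
    U = filter P? O
    U⊆O : ∀ {v} → v ∈ U → v ∈ O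
    U⊆O = proj₁ ∘ ∈-filter⁻ P? {xs = O}
    n≤ : length W ≤ 2 * length U + (2 + z)
    n≤ = ≤-trans (≤-reflexive (sym (length-members+others r∈ m)))
           (≤-trans (+-mono-≤ (≤-reflexive (sym 2+z≡w)) O≤) (≤-reflexive (+-comm (2 + z) _)))
    members∉ : ∀ {v} → v ∈ members m → v ∉ O
    members∉ v∈ v∈O = proj₂ (∈-others⁻ r∈ m v∈O) (proj₂ (∈-members⁻ r∈ m v∈))

    sizes : suc w + 0 ≡ suc s → suc τ ≤ length U × suc τ < length O
    sizes eq =
      *-cancelˡ-< 2 τ _ (+-cancelʳ-≤ (2 + z) _ _
        (≤-trans (≤-reflexive (sym (+-suc (2 * τ) (2 + z)))) (≤-trans 2τ+ n≤))) ,
      +-cancelʳ-≤ (2 + z) _ _ (≤-trans (≤-by 0 (≤-trans (s≤s z≤n) 2≤τ) (eq₂ τ z))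
        (≤-trans 2τ+ (≤-reflexive (trans (sym (length-members+others r∈ m))
          (trans (cong (_+ length O) (sym 2+z≡w)) (+-comm (2 + z) _))))))
      where
      2τ+ : 2 * τ + (3 + z) ≤ length W
      2τ+ = Suffices⇒size z τ (length W) (subst (λ s → Suffices s τ (length W))
              (trans (sym eq) (trans (+-identityʳ (suc w)) (cong suc (sym 2+z≡w)))) cond)
      eq₂ : ∀ τ z → suc (suc τ) + (2 + z) + τ + 0 ≡ 2 * τ + (3 + z) + 1
      eq₂ = solve-∀

    one-more : suc w + 0 ≡ suc s →
      (∃₂ λ a bs → a ∈ O × a ∉ bs × length bs ≡ suc τ × Unique bs × All (λ b → b ∈ O × P b) bs) →
      Orderable-K W (suc s) (suc τ)
    one-more eq (a , bs , a∈ , a∉bs , length-bs , bs! , bsOK) = record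
      { word = All.tabulate (λ x∈ → member-mono r∈ m x∈ (All.map proj₁ bsOK) mono-r-bs)
               ++ˡ star (All.map (λ {b} _ → χ b a , refl ∷ []) bsOK)
      ; length-as = trans (length-++ (members m)) (trans (+-comm w 1) (trans (sym (+-identityʳ _)) eq))
      ; length-bs = length-bs
      ; as∈ = All.++⁺ (All.tabulate (proj₁ ∘ ∈-members⁻ r∈ m)) (proj₁ (∈-others⁻ r∈ m a∈) ∷ [])
      ; bs∈ = All.map (proj₁ ∘ ∈-others⁻ r∈ m ∘ proj₁) bsOK
      ; as! = Unique.++⁺ (Unique.filter⁺ (M? m) W!) ([] ∷ []) (λ { (x∈ , here refl) → members∉ x∈ a∈ })
      ; bs! = bs!
      ; disjoint = λ (x∈as , x∈bs) → [ (λ x∈ → members∉ x∈ (proj₁ (All.lookup bsOK x∈bs)))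
                                     , (λ { (here refl) → a∉bs x∈bs }) ]′ (∈-++⁻ (members m) x∈as)
      }
      where
      mono-r-bs : Mono r bs
      mono-r-bs = proj₁ mono-r , All.map (λ (b∈ , Pb) → All.lookup (proj₂ mono-r) (∈-filter⁺ P? b∈ Pb)) bsOK

    prepend : ∀ {d} → suc w + suc d ≡ suc s → Orderable-K U (2 + d) (suc τ) → Orderable-K W (suc s) (suc τ)
    prepend {d} eq k = record
      { word = All.tabulate (λ x∈ → member-mono r∈ m x∈ (All.map U⊆O bs∈) mono-r-bs) ++ˡ word
      ; length-as = trans (length-++ (members m)) (trans (cong (w +_) length-as) (trans (+-suc w (suc d)) eq))
      ; length-bs = length-bs
      ; as∈ = All.++⁺ (All.tabulate (proj₁ ∘ ∈-members⁻ r∈ m)) (All.map U⊆W as∈)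
      ; bs∈ = All.map U⊆W bs∈
      ; as! = Unique.++⁺ (Unique.filter⁺ (M? m) W!) as! (λ (x∈ , x∈as) → members∉ x∈ (U⊆O (All.lookup as∈ x∈as)))
      ; bs! = bs!
      ; disjoint = λ (x∈as , x∈bs) → [ (λ x∈ → members∉ x∈ (U⊆O (All.lookup bs∈ x∈bs)))
                                     , (λ x∈ → disjoint (x∈ , x∈bs)) ]′ (∈-++⁻ (members m) x∈as)
      }
      where
      open Orderable-K k
      U⊆W : ∀ {v} → v ∈ U → v ∈ W
      U⊆W = proj₁ ∘ ∈-others⁻ r∈ m ∘ U⊆O
      mono-r-bs : Mono r bs
      mono-r-bs = proj₁ mono-r , All.map (All.lookup (proj₂ mono-r)) bs∈

    smaller : length U < length W
    smaller = ≤-trans (s≤s (length-filter P? O))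
      (≤-trans (+-monoˡ-≤ (length O) (≤-trans (s≤s z≤n) (≤-reflexive 2+z≡w)))
               (≤-reflexive (length-members+others r∈ m)))

    rest-size : ∀ d → suc w + suc d ≡ suc s → suc s ≡ 2 + d + (2 + z)
    rest-size d eq = trans (sym eq) (trans (cong (λ w → suc w + suc d) (sym 2+z≡w)) (eq₃ z d))
      where
      eq₃ : ∀ z d → suc (2 + z) + suc d ≡ 2 + d + (2 + z)
      eq₃ = solve-∀

    split : ∀ d → suc w + d ≡ suc s → Orderable-K W (suc s) (suc τ)
    -- The s-side lacks `suc d` vertices. When it lacks one, the bounds give only `suc τ` vertices
    -- in `U`, one too few to find the rest there. But a last vertex on the s-side imposes no
    -- condition on colors, so it may be any further vertex of `O`.
    split zero eq = one-more eq
      (spare P? (suc τ) (Unique.filter⁺ (¬? ∘ M? m) W!) (proj₁ (sizes eq)) (proj₂ (sizes eq)))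
    split (suc d) eq = prepend eq (hyp (suc d) τ smaller (Unique.filter⁺ P? (Unique.filter⁺ (¬? ∘ M? m) W!))
      (Suffices-module d z τ (length W) (length U) 2≤τ n≤ (subst (λ s → Suffices s τ (length W)) (rest-size d eq) cond)))

  small-module : ∀ {r W s τ κ} → Hypothesis (length W) → Unique W → r ∈ W → (m : Module r W) →
    2 ≤ length (members m) → length (members m) < suc s → TwoColored r κ (others m) →
    2 ≤ τ → Suffices (suc s) τ (length W) → Orderable-K W (suc s) (suc τ)
  small-module {r} {W} {s} {τ} {κ} hyp W! r∈ m 2≤w w<s two 2≤τ cond
    with P , P? , O≤ , mono-r ← majority two
    with z , 2+z≡w ← m≤n⇒∃[o]m+o≡n 2≤w
    with d , w+d≡s ← m≤n⇒∃[o]m+o≡n w<s =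
    prepend-module hyp W! r∈ m P? O≤ mono-r z 2+z≡w 2≤τ cond d w+d≡s

  -- Avoids `u`, so that `χ u (pick x y u)` is the color of an actual edge at `u` and can serve as
  -- its reference color.
  pick : V → V → V → V
  pick x y u = if does (x ≟ u) then y else x

  pick-≢ : ∀ {x y u} → x ≢ y → pick x y u ≢ u
  pick-≢ {x} {y} {u} x≢y with x ≟ u
  ... | yes refl = ≢-sym x≢y
  ... | no  x≢u  = x≢u

  pick-∈ : ∀ {W x y} u → x ∈ W → y ∈ W → pick x y u ∈ W
  pick-∈ {x = x} u x∈ y∈ with x ≟ u
  ... | yes _ = y∈
  ... | no  _ = x∈

  three-colors : ∀ {r W s τ o x y} → Hypothesis (length W) → Unique W → (suc s ≤ 2 ⊎ 2 ≤ τ) →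
    Suffices (suc s) τ (length W) → r ∈ W →
    let O = others (singleton r W) in
    x ∈ O → y ∈ O → o ∈ O → χ r x ≢ χ r y → χ r x ≢ χ r o → χ r y ≢ χ r o →
    Orderable-K W (suc s) (suc τ)
  three-colors {r} {W} {s} hyp W! small cond r∈ x∈ y∈ o∈ x≢y x≢o y≢o
    with m₁ , larger₁ , proper₁ ← grow W! r∈ (singleton r W) x∈ y∈ o∈ x≢y x≢o y≢o
    with growUntil (suc s) (suc s) W! r∈ m₁ proper₁ (m≤m+n (suc s) _)
  ... | m , proper , larger , inj₁ s≤ = large-module hyp W! r∈ m proper s≤ cond
  ... | m , proper , larger , inj₂ (w<s , κ , two) =
    small-module hyp W! r∈ m 2≤w w<s two
      -- After one `grow` the module has at least two vertices, so for `suc s ≤ 2` it cannot be too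
      -- small.
      ([ (λ s≤2 → contradiction (≤-trans w<s s≤2) (≤⇒≯ 2≤w)) , id ]′ small) cond
    where
    2≤w : 2 ≤ length (members m)
    2≤w = ≤-trans (s≤s (∈⇒1≤length (∈-filter⁺ (_≟ r) r∈ refl))) (≤-trans larger₁ larger)

  step : ∀ {W s τ} → Hypothesis (length W) → Unique W → (suc s ≤ 2 ⊎ 2 ≤ τ) →
    Suffices (suc s) τ (length W) → Orderable-K W (suc s) (suc τ)
  step {[]} {s} {τ} hyp W! small cond = contradiction (Suffices⇒< {s} {τ} cond) λ ()
  step {_ ∷ []} {s} {τ} hyp W! small cond = contradiction (Suffices⇒< {s} {τ} cond) λ { (s≤s ()) }
  step {W@(x ∷ y ∷ _)} {s} {τ} hyp W!@((x≢y ∷ _) ∷ _) small cond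
    with All.decide (λ r → twoColored⊎ r (κ r) (others (singleton r W))) W
    where
    κ : V → C
    κ r = χ r (pick x y r)
  ... | inj₁ two = averaging⇒K (λ r → χ r (pick x y r))
    (λ r∈ x∈ y∈ x≢ y≢ → All.lookup two r∈
      (∈-filter⁺ (¬? ∘ (_≟ _)) x∈ x≢) (∈-filter⁺ (¬? ∘ (_≟ _)) y∈ y≢)) W! cond
  ... | inj₂ three with r , r∈ , _ , _ , x∈ , y∈ , x≢y′ , x≢o , y≢o ← find three =
    three-colors hyp W! small cond r∈ x∈ y∈
      (∈-filter⁺ (¬? ∘ (_≟ r)) (pick-∈ r (here refl) (there (here refl))) (pick-≢ x≢y)) x≢y′ x≢o y≢o

  one-sided : ∀ {W s} → Unique W → suc s < length W → Orderable-K W (suc s) 1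
  one-sided {b ∷ W} {s} (b∉ ∷ W!) (s≤s s<) = record
    { word = flip (star (All.tabulate λ {a} _ → χ a b , refl ∷ []))
    ; length-as = length-take-≤ (suc s) W s<
    ; length-bs = refl
    ; as∈ = All.tabulate (there ∘ ∈-take⁻ (suc s))
    ; bs∈ = here refl ∷ []
    ; as! = Unique.take⁺ (suc s) W!
    ; bs! = [] ∷ []
    ; disjoint = λ { (x∈ , here refl) → All.lookup b∉ (∈-take⁻ (suc s) x∈) refl }
    }

  -- `step` does not apply when `suc s ≥ 3` and `τ ≤ 1`. For τ = 0 a single vertex on the t-side
  -- makes every order work; for τ = 1 exchanging the sides on the same vertex set leads to an
  -- s-side of size 2.
  orderable-K : ∀ n {W} s τ → length W < n → Unique W → Suffices (suc s) τ (length W) →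
    Orderable-K W (suc s) (suc τ)
  orderable-K (suc n) {W} s τ (s≤s len) W! cond = cases s τ cond
    where
    hyp : Hypothesis (length W)
    hyp s τ smaller = orderable-K n s τ (≤-trans smaller len)
    cases : ∀ s τ → Suffices (suc s) τ (length W) → Orderable-K W (suc s) (suc τ)
    cases 0 τ cond = step hyp W! (inj₁ (s≤s z≤n)) cond
    cases 1 τ cond = step hyp W! (inj₁ ≤-refl) cond
    cases (suc (suc z)) (suc (suc τ)) cond = step hyp W! (inj₂ (s≤s (s≤s z≤n))) cond
    cases s@(suc (suc z)) 0 cond = one-sided W! (Suffices⇒< cond)
    cases (suc (suc z)) 1 cond = transpose (step {s = 1} {τ = 2 + z} hyp W! (inj₁ ≤-refl) (Suffices-swap z _ cond))

-- From words to orderable copies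

lookup-injective : ∀ {A : Set} {xs : List A} → Unique xs → ∀ {i j} → lookup xs i ≡ lookup xs j → i ≡ j
lookup-injective (x∉ ∷ xs!) {zero}  {zero}  eq = refl
lookup-injective (x∉ ∷ xs!) {zero}  {suc j} eq = contradiction eq (All.lookup x∉ (∈-lookup j))
lookup-injective (x∉ ∷ xs!) {suc i} {zero}  eq = contradiction (sym eq) (All.lookup x∉ (∈-lookup i))
lookup-injective (x∉ ∷ xs!) {suc i} {suc j} eq = cong suc (lookup-injective xs! eq)

fromPred : ∀ {p} → Fin (p ∸ 1) → Fin p
fromPred {suc _} k = inject₁ k

toℕ-fromPred : ∀ {p} (k : Fin (p ∸ 1)) → toℕ (fromPred {p} k) ≡ toℕ k
toℕ-fromPred {suc _} k = Fin.toℕ-inject₁ k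

module FromWord {n : ℕ} {C : Set} (χ : EdgeColoring (complete n) C) where
  open EdgeColoring χ using (color)
  open Words color

  -- Computed along the word so that positions match its constructors; the sum of the two lengths
  -- does not unfold this way at `_∷ʳ_`.
  size : ∀ {as bs} → Word as bs → ℕ
  size []       = 0
  size (_ ∷ˡ w) = suc (size w)
  size (_ ∷ʳ w) = suc (size w)

  size≡ : ∀ {as bs} (w : Word as bs) → size w ≡ length as + length bs
  size≡ []                 = refl
  size≡ (_ ∷ˡ w)           = cong suc (size≡ w)
  size≡ {as} (_ ∷ʳ w)      = trans (cong suc (size≡ w)) (sym (+-suc (length as) _))

  at : ∀ {as bs} (w : Word as bs) → Fin (size w) → Fin (length as) ⊎ Fin (length bs)
  at (_ ∷ˡ w) zero    = inj₁ zero
  at (_ ∷ˡ w) (suc i) = Sum.map suc id (at w i)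
  at (_ ∷ʳ w) zero    = inj₂ zero
  at (_ ∷ʳ w) (suc i) = Sum.map id suc (at w i)

  at⁻¹ : ∀ {as bs} (w : Word as bs) → Fin (length as) ⊎ Fin (length bs) → Fin (size w)
  at⁻¹ (_ ∷ˡ w) (inj₁ zero)    = zero
  at⁻¹ (_ ∷ˡ w) (inj₁ (suc i)) = suc (at⁻¹ w (inj₁ i))
  at⁻¹ (_ ∷ˡ w) (inj₂ j)       = suc (at⁻¹ w (inj₂ j))
  at⁻¹ (_ ∷ʳ w) (inj₂ zero)    = zero
  at⁻¹ (_ ∷ʳ w) (inj₂ (suc j)) = suc (at⁻¹ w (inj₂ j))
  at⁻¹ (_ ∷ʳ w) (inj₁ i)       = suc (at⁻¹ w (inj₁ i))

  at-at⁻¹ : ∀ {as bs} (w : Word as bs) x → at w (at⁻¹ w x) ≡ x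
  at-at⁻¹ (_ ∷ˡ w) (inj₁ zero)    = refl
  at-at⁻¹ (_ ∷ˡ w) (inj₁ (suc i)) = cong (Sum.map suc id) (at-at⁻¹ w (inj₁ i))
  at-at⁻¹ (_ ∷ˡ w) (inj₂ j)       = cong (Sum.map suc id) (at-at⁻¹ w (inj₂ j))
  at-at⁻¹ (_ ∷ʳ w) (inj₂ zero)    = refl
  at-at⁻¹ (_ ∷ʳ w) (inj₂ (suc j)) = cong (Sum.map id suc) (at-at⁻¹ w (inj₂ j))
  at-at⁻¹ (_ ∷ʳ w) (inj₁ i)       = cong (Sum.map id suc) (at-at⁻¹ w (inj₁ i))

  at⁻¹-at : ∀ {as bs} (w : Word as bs) i → at⁻¹ w (at w i) ≡ i
  at⁻¹-at (_ ∷ˡ w) zero    = refl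
  at⁻¹-at (_ ∷ˡ w) (suc i) with at w i | at⁻¹-at w i
  ... | inj₁ _ | eq = cong suc eq
  ... | inj₂ _ | eq = cong suc eq
  at⁻¹-at (_ ∷ʳ w) zero    = refl
  at⁻¹-at (_ ∷ʳ w) (suc i) with at w i | at⁻¹-at w i
  ... | inj₁ _ | eq = cong suc eq
  ... | inj₂ _ | eq = cong suc eq

  vertex : ∀ as bs → Fin (length as) ⊎ Fin (length bs) → Fin n
  vertex as bs = [ lookup as , lookup bs ]′

  forward : ∀ {as bs} (w : Word as bs) → Fin (size w) → C
  forward ((c , _) ∷ˡ w) zero    = c
  forward ((c , _) ∷ʳ w) zero    = c
  forward (_ ∷ˡ w)       (suc i) = forward w i
  forward (_ ∷ʳ w)       (suc i) = forward w i

  forward-color : ∀ {as bs} (w : Word as bs) {i j} → i <ᶠ j → Across (at w i) (at w j) →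
    color (vertex as bs (at w i)) (vertex as bs (at w j)) ≡ forward w i
  forward-color ((c , monos) ∷ˡ w) {zero} {suc j} _ adj with at w j
  ... | inj₂ y = All.lookup monos (∈-lookup y)
  forward-color ((c , monos) ∷ʳ w) {zero} {suc j} _ adj with at w j
  ... | inj₁ x = All.lookup monos (∈-lookup x)
  forward-color (_ ∷ˡ w) {suc i} {suc j} (s≤s i<j) adj with at w i | at w j | forward-color w {i} {j} i<j
  ... | inj₁ _ | inj₂ _ | eq = eq adj
  ... | inj₂ _ | inj₁ _ | eq = eq adj
  forward-color (_ ∷ʳ w) {suc i} {suc j} (s≤s i<j) adj with at w i | at w j | forward-color w {i} {j} i<j
  ... | inj₁ _ | inj₂ _ | eq = eq adj
  ... | inj₂ _ | inj₁ _ | eq = eq adj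

  module _ {as bs} (w : Word as bs) where

    private
      s = length as
      t = length bs

    position : Fin (s + t) → Fin (size w)
    position = cast (sym (size≡ w))

    order : Permutation′ (s + t)
    order = permutation
      (join s t ∘ at w ∘ position)
      (cast (size≡ w) ∘ at⁻¹ w ∘ splitAt s)
      (λ x → trans (cong (join s t ∘ at w) (Fin.cast-involutive (sym (size≡ w)) (size≡ w) _))
               (trans (cong (join s t) (at-at⁻¹ w _)) (Fin.join-splitAt s t x)))
      (λ i → trans (cong (cast (size≡ w) ∘ at⁻¹ w) (Fin.splitAt-join s t _))
               (trans (cong (cast (size≡ w)) (at⁻¹-at w _)) (Fin.cast-involutive (size≡ w) (sym (size≡ w)) i)))

    embedding : Fin (s + t) → Fin n
    embedding = vertex as bs ∘ splitAt s

    word⇒copy : Unique as → Unique bs → (∀ {v} → v ∈ as → v ∉ bs) → HasOrderableCopy (completeBipartite s t) χ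
    word⇒copy as! bs! disjoint = record
      { embed = embedding
      ; injective = λ {u} {v} eq → trans (sym (Fin.join-splitAt s t u))
          (trans (cong (join s t) (vertex-injective (splitAt s u) (splitAt s v) eq)) (Fin.join-splitAt s t v))
      ; adj = λ {u} {v} → separate (splitAt s u) (splitAt s v)
      } , order , tabulate (forward w ∘ position ∘ fromPred) , colored
      where
      vertex-injective : ∀ x y → vertex as bs x ≡ vertex as bs y → x ≡ y
      vertex-injective (inj₁ i) (inj₁ j) eq = cong inj₁ (lookup-injective as! eq)
      vertex-injective (inj₁ i) (inj₂ j) eq = contradiction (subst (_∈ bs) (sym eq) (∈-lookup j)) (disjoint (∈-lookup i))
      vertex-injective (inj₂ i) (inj₁ j) eq = contradiction (subst (_∈ bs) eq (∈-lookup i)) (disjoint (∈-lookup j))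
      vertex-injective (inj₂ i) (inj₂ j) eq = cong inj₂ (lookup-injective bs! eq)
      separate : ∀ x y → Across x y → vertex as bs x ≢ vertex as bs y
      separate x y adj eq with vertex-injective x y eq
      ... | refl = across-irrefl x adj
      split-order : ∀ i → splitAt s (join s t (at w (position i))) ≡ at w (position i)
      split-order i = Fin.splitAt-join s t _
      colored : ∀ i j k → toℕ k ≡ toℕ i → i <ᶠ j →
        Across (splitAt s (join s t (at w (position i)))) (splitAt s (join s t (at w (position j)))) →
        color (embedding (join s t (at w (position i)))) (embedding (join s t (at w (position j)))) ≡
        Vec.lookup (tabulate (forward w ∘ position ∘ fromPred)) k
      colored i j k k≡i i<j adj rewrite split-order i | split-order j = trans
        (forward-color w (subst₂ _<_ (sym (Fin.toℕ-cast _ i)) (sym (Fin.toℕ-cast _ j)) i<j) adj)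
        (trans (cong (forward w ∘ position) (Fin.toℕ-injective (trans (sym k≡i) (sym (toℕ-fromPred k)))))
          (sym (lookup∘tabulate (forward w ∘ position ∘ fromPred) k)))

  orderable-K⇒copy : ∀ {W s t} → Orderable-K W s t → HasOrderableCopy (completeBipartite s t) χ
  orderable-K⇒copy record { word = w ; length-as = refl ; length-bs = refl
                          ; as! = as! ; bs! = bs! ; disjoint = disjoint } =
    word⇒copy w as! bs! (λ v∈as v∈bs → disjoint (v∈as , v∈bs))

open EdgeColoring using (color)

-- Decidability

-- A function is only pointwise equal to the one rebuilt from its enumerated values, so `P` has to
-- respect `_≗_`.
anyFun? : ∀ m {n} {P : (Fin m → Fin n) → Set} → (∀ {f g} → f ≗ g → P f → P g) →
  (∀ f → Dec (P f)) → Dec (∃ P)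
anyFun? zero {P = P} resp P? = map′ (λ p → _ , p) (λ (f , p) → resp (λ ()) p) (P? λ ())
anyFun? (suc m) {P = P} resp P? = map′
  (λ (x , f , p) → x Vector.∷ f , p)
  (λ (f , p) → f zero , f ∘ suc , resp (λ { zero → refl ; (suc _) → refl }) p)
  (Fin.any? λ x → anyFun? m (λ f≗g → resp (λ { zero → refl ; (suc i) → f≗g i })) (P? ∘ (x Vector.∷_)))

allFun? : ∀ m {n} {P : (Fin m → Fin n) → Set} → (∀ {f g} → f ≗ g → P f → P g) →
  (∀ f → Dec (P f)) → Dec (∀ f → P f)
allFun? m resp P? = map′
  (λ none f → decidable-stable (P? f) (λ ¬p → none (f , ¬p)))
  (λ all (f , ¬p) → ¬p (all f))
  (¬? (anyFun? m (λ f≗g ¬p p → ¬p (resp (sym ∘ f≗g) p)) (¬? ∘ P?)))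

orderable-map : ∀ {G n} {C D : Set} (χ : EdgeColoring (complete n) C) (χ′ : EdgeColoring (complete n) D)
  (g : C → D) → (∀ u v → g (color χ u v) ≡ color χ′ u v) →
  HasOrderableCopy G χ → HasOrderableCopy G χ′
orderable-map χ χ′ g eq (f , v , c , ok) = f , v , Vec.map g c , λ i j k k≡i i<j adj →
  trans (sym (eq _ _)) (trans (cong g (ok i j k k≡i i<j adj)) (sym (lookup-map k g c)))

rainbow-map : ∀ {G n} {C D : Set} (χ : EdgeColoring (complete n) C) (χ′ : EdgeColoring (complete n) D)
  (h : D → C) → (∀ u v → color χ u v ≡ h (color χ′ u v)) →
  HasRainbowCopy G χ → HasRainbowCopy G χ′
rainbow-map χ χ′ h eq (f , rainbow) = f , λ uv xy distinct same →
  rainbow uv xy distinct (trans (eq _ _) (trans (cong h same) (sym (eq _ _))))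

-- A copy is coded by plain functions between finite sets: the embedding, the ordering, its inverse
-- and the list of colors. Adjacency in the complete graph follows from injectivity and
-- irreflexivity.
hasOrderableCopy? : ∀ G {n q} (χ : EdgeColoring (complete n) (Fin q)) → Dec (HasOrderableCopy G χ)
hasOrderableCopy? G {n} {q} χ = map′ to from
  (anyFun? p respᵉ λ e → injective? e ×-dec
   anyFun? p (respᵛ e) λ v →
   anyFun? p (respʷ e v) λ w → inverse? v w ×-dec
   anyFun? (p ∸ 1) (respᶜ e v) (colored? e v))
  where
  open Graph G using (Adj; adj?; irrefl) renaming (order to p)

  Colored : (Fin p → Fin n) → (Fin p → Fin p) → (Fin (p ∸ 1) → Fin q) → Set
  Colored e v c = ∀ i j k → toℕ k ≡ toℕ i → i <ᶠ j → Adj (v i) (v j) →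
    color χ (e (v i)) (e (v j)) ≡ c k

  Inverses : (Fin p → Fin p) → (Fin p → Fin p) → Set
  Inverses v w = (∀ i → v (w i) ≡ i) × (∀ i → w (v i) ≡ i)

  Inj : (Fin p → Fin n) → Set
  Inj e = ∀ i j → e i ≡ e j → i ≡ j

  Ordered : (Fin p → Fin n) → (Fin p → Fin p) → Set
  Ordered e v = ∃ λ w → Inverses v w × ∃ (Colored e v)

  colored? : ∀ e v c → Dec (Colored e v c)
  colored? e v c = Fin.all? λ i → Fin.all? λ j → Fin.all? λ k →
    (toℕ k ℕ.≟ toℕ i) →-dec ((i Fin.<? j) →-dec (adj? (v i) (v j) →-dec (_ Fin.≟ _)))

  inverse? : ∀ v w → Dec (Inverses v w)
  inverse? v w = (Fin.all? λ i → _ Fin.≟ i) ×-dec (Fin.all? λ i → _ Fin.≟ i)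

  injective? : ∀ e → Dec (Inj e)
  injective? e = Fin.all? λ i → Fin.all? λ j → (e i Fin.≟ e j) →-dec (i Fin.≟ j)

  respᶜ : ∀ e v {c d} → c ≗ d → Colored e v c → Colored e v d
  respᶜ e v c≗d ok i j k k≡i i<j adj = trans (ok i j k k≡i i<j adj) (c≗d k)

  respʷ : ∀ e v {w w′} → w ≗ w′ → Inverses v w × ∃ (Colored e v) → Inverses v w′ × ∃ (Colored e v)
  respʷ e v w≗w′ ((vw , wv) , ok) =
    ((λ i → trans (cong v (sym (w≗w′ i))) (vw i)) , (λ i → trans (sym (w≗w′ (v i))) (wv i))) , ok

  respᵛ : ∀ e {v v′} → v ≗ v′ → Ordered e v → Ordered e v′
  respᵛ e v≗v′ (w , (vw , wv) , c , ok) =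
    w , ((λ i → trans (sym (v≗v′ (w i))) (vw i)) , (λ i → trans (cong w (sym (v≗v′ i))) (wv i))) , c ,
    λ i j k k≡i i<j adj → trans (cong₂ (λ x y → color χ (e x) (e y)) (sym (v≗v′ i)) (sym (v≗v′ j)))
      (ok i j k k≡i i<j (subst₂ Adj (sym (v≗v′ i)) (sym (v≗v′ j)) adj))

  respᵉ : ∀ {e e′} → e ≗ e′ → Inj e × ∃ (Ordered e) → Inj e′ × ∃ (Ordered e′)
  respᵉ e≗e′ (inj , v , w , vw , c , ok) =
    (λ i j eq → inj i j (trans (e≗e′ i) (trans eq (sym (e≗e′ j))))) , v , w , vw , c ,
    λ i j k k≡i i<j adj → trans (cong₂ (color χ) (sym (e≗e′ (v i))) (sym (e≗e′ (v j)))) (ok i j k k≡i i<j adj)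

  to : (∃ λ e → Inj e × ∃ (Ordered e)) → HasOrderableCopy G χ
  to (e , inj , v , w , (vw , wv) , c , ok) =
    record { embed = e ; injective = inj _ _
           ; adj = λ {u} {v} uv eq → irrefl v (subst (λ x → Adj x v) (inj u v eq) uv) } ,
    permutation v w vw wv , Vec.tabulate c ,
    λ i j k k≡i i<j adj → trans (ok i j k k≡i i<j adj) (sym (lookup∘tabulate c k))

  from : HasOrderableCopy G χ → ∃ λ e → Inj e × ∃ (Ordered e)
  from (f , v , c , ok) = embed , (λ _ _ → injective) , v ⟨$⟩ʳ_ , v ⟨$⟩ˡ_ ,
    ((λ _ → inverseʳ v) , (λ _ → inverseˡ v)) , Vec.lookup c , ok
    where open Copy f

-- Rainbow triangles

module _ {n} {C : Set} (χ : EdgeColoring (complete n) C) where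

  RainbowTriangle : Fin n → Fin n → Fin n → Set
  RainbowTriangle x y z = (x ≢ y × y ≢ z × x ≢ z) ×
    (color χ x y ≢ color χ y z × color χ x y ≢ color χ x z × color χ y z ≢ color χ x z)

  rainbow⇒triangle : HasRainbowCopy (complete 3) χ → ∃ λ x → ∃₂ (RainbowTriangle x)
  rainbow⇒triangle (f , rainbow) = embed zero , embed (suc zero) , embed (suc (suc zero)) ,
    (adj {zero} {suc zero} (λ ()) , adj {suc zero} {suc (suc zero)} (λ ()) , adj {zero} {suc (suc zero)} (λ ())) ,
    rainbow {zero} {suc zero} {suc zero} {suc (suc zero)} (λ ()) (λ ()) (λ { (inj₁ ()) ; (inj₂ ()) }) ,
    rainbow {zero} {suc zero} {zero} {suc (suc zero)} (λ ()) (λ ()) (λ { (inj₁ ()) ; (inj₂ ()) }) ,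
    rainbow {suc zero} {suc (suc zero)} {zero} {suc (suc zero)} (λ ()) (λ ()) (λ { (inj₁ ()) ; (inj₂ ()) })
    where open Copy f

  private
    -- Names an edge of the triangle by the vertex it misses. The last clause covers the edge
    -- missing `zero` and, as a default, the diagonal.
    opposite : Fin 3 → Fin 3 → Fin 3
    opposite zero             (suc zero)       = suc (suc zero)
    opposite (suc zero)       zero             = suc (suc zero)
    opposite zero             (suc (suc zero)) = suc zero
    opposite (suc (suc zero)) zero             = suc zero
    opposite _                _                = zero

    opposite-injective : ∀ u v x y → u ≢ v → x ≢ y → opposite u v ≡ opposite x y →
      (u ≡ x × v ≡ y) ⊎ (u ≡ y × v ≡ x)
    opposite-injective = from-yes (Fin.all? λ u → Fin.all? λ v → Fin.all? λ x → Fin.all? λ y →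
      ¬? (u Fin.≟ v) →-dec (¬? (x Fin.≟ y) →-dec ((opposite u v Fin.≟ opposite x y) →-dec
        (((u Fin.≟ x) ×-dec (v Fin.≟ y)) ⊎-dec ((u Fin.≟ y) ×-dec (v Fin.≟ x))))))

  triangle⇒rainbow : ∀ {x y z} → RainbowTriangle x y z → HasRainbowCopy (complete 3) χ
  triangle⇒rainbow {x} {y} {z} ((x≢y , y≢z , x≢z) , xy≢yz , xy≢xz , yz≢xz) =
    record { embed = e ; injective = e-injective _ _ ; adj = λ u≢v eq → u≢v (e-injective _ _ eq) } ,
    λ {u} {v} {u′} {v′} u≢v u′≢v′ distinct eq → distinct (opposite-injective u v u′ v′ u≢v u′≢v′
      (side-injective _ _ (trans (sym (color-side u v u≢v)) (trans eq (color-side u′ v′ u′≢v′)))))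
    where
    e : Fin 3 → Fin n
    e zero             = x
    e (suc zero)       = y
    e (suc (suc zero)) = z
    e-injective : ∀ i j → e i ≡ e j → i ≡ j
    e-injective zero             zero             _  = refl
    e-injective zero             (suc zero)       eq = contradiction eq x≢y
    e-injective zero             (suc (suc zero)) eq = contradiction eq x≢z
    e-injective (suc zero)       zero             eq = contradiction (sym eq) x≢y
    e-injective (suc zero)       (suc zero)       _  = refl
    e-injective (suc zero)       (suc (suc zero)) eq = contradiction eq y≢z
    e-injective (suc (suc zero)) zero             eq = contradiction (sym eq) x≢z
    e-injective (suc (suc zero)) (suc zero)       eq = contradiction (sym eq) y≢z
    e-injective (suc (suc zero)) (suc (suc zero)) _  = refl
    side : Fin 3 → C
    side zero             = color χ y z
    side (suc zero)       = color χ x z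
    side (suc (suc zero)) = color χ x y
    side-injective : ∀ i j → side i ≡ side j → i ≡ j
    side-injective zero             zero             _  = refl
    side-injective zero             (suc zero)       eq = contradiction eq yz≢xz
    side-injective zero             (suc (suc zero)) eq = contradiction (sym eq) xy≢yz
    side-injective (suc zero)       zero             eq = contradiction (sym eq) yz≢xz
    side-injective (suc zero)       (suc zero)       _  = refl
    side-injective (suc zero)       (suc (suc zero)) eq = contradiction (sym eq) xy≢xz
    side-injective (suc (suc zero)) zero             eq = contradiction eq xy≢yz
    side-injective (suc (suc zero)) (suc zero)       eq = contradiction eq xy≢xz
    side-injective (suc (suc zero)) (suc (suc zero)) _  = refl
    color-side : ∀ u v → u ≢ v → color χ (e u) (e v) ≡ side (opposite u v)
    color-side zero             zero             u≢u = contradiction refl u≢u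
    color-side zero             (suc zero)       _   = refl
    color-side zero             (suc (suc zero)) _   = refl
    color-side (suc zero)       zero             _   = EdgeColoring.sym χ y x
    color-side (suc zero)       (suc zero)       u≢u = contradiction refl u≢u
    color-side (suc zero)       (suc (suc zero)) _   = refl
    color-side (suc (suc zero)) zero             _   = EdgeColoring.sym χ z x
    color-side (suc (suc zero)) (suc zero)       _   = EdgeColoring.sym χ z y
    color-side (suc (suc zero)) (suc (suc zero)) u≢u = contradiction refl u≢u

hasRainbowTriangle? : ∀ {n q} (χ : EdgeColoring (complete n) (Fin q)) → Dec (HasRainbowCopy (complete 3) χ)
hasRainbowTriangle? χ = map′ (λ (x , y , z , rainbow) → triangle⇒rainbow χ {x} {y} {z} rainbow) (rainbow⇒triangle χ)
  (Fin.any? λ x → Fin.any? λ y → Fin.any? λ z →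
    (¬? (x Fin.≟ y) ×-dec ¬? (y Fin.≟ z) ×-dec ¬? (x Fin.≟ z)) ×-dec
    (¬? (_ Fin.≟ _) ×-dec ¬? (_ Fin.≟ _) ×-dec ¬? (_ Fin.≟ _)))

no-rainbow⇒gallai : ∀ {n q} (χ : EdgeColoring (complete n) (Fin q)) → ¬ HasRainbowCopy (complete 3) χ →
  ∀ {x y z} → x ≢ y → y ≢ z → x ≢ z → color χ x y ≢ color χ y z →
  color χ x z ≡ color χ x y ⊎ color χ x z ≡ color χ y z
no-rainbow⇒gallai χ none {x} {y} {z} x≢y y≢z x≢z xy≢yz
  with color χ x z Fin.≟ color χ x y | color χ x z Fin.≟ color χ y z
... | yes eq | _      = inj₁ eq
... | no _   | yes eq = inj₂ eq
... | no xz≢xy | no xz≢yz = contradiction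
  (triangle⇒rainbow χ ((x≢y , y≢z , x≢z) , xy≢yz , ≢-sym xz≢xy , ≢-sym xz≢yz)) none

two-colors⇒no-rainbow : ∀ {n} (χ : EdgeColoring (complete n) (Fin 2)) → ¬ HasRainbowCopy (complete 3) χ
two-colors⇒no-rainbow χ copy with x , y , z , _ , xy≢yz , xy≢xz , yz≢xz ← rainbow⇒triangle χ copy =
  pigeon (color χ x y) (color χ y z) (color χ x z) xy≢yz xy≢xz yz≢xz
  where
  pigeon : (a b c : Fin 2) → a ≢ b → a ≢ c → b ≢ c → ⊥
  pigeon zero       zero       _          a≢b _ _ = a≢b refl
  pigeon zero       (suc zero) zero       _ a≢c _ = a≢c refl
  pigeon zero       (suc zero) (suc zero) _ _ b≢c = b≢c refl
  pigeon (suc zero) zero       zero       _ _ b≢c = b≢c refl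
  pigeon (suc zero) zero       (suc zero) _ a≢c _ = a≢c refl
  pigeon (suc zero) (suc zero) _          a≢b _ _ = a≢b refl

-- Every edge-coloring arises from a function on Fin (n * n) by symmetrization.
symmetrize : ∀ n {q} → (Fin (n * n) → Fin q) → EdgeColoring (complete n) (Fin q)
symmetrize n g = record { color = λ u v → c u v (toℕ u ℕ.≤? toℕ v) ; sym = symm }
  where
  c : ∀ u v → Dec (toℕ u ≤ toℕ v) → _
  c u v (yes _) = g (combine u v)
  c u v (no  _) = g (combine v u)
  symm : ∀ u v → c u v (toℕ u ℕ.≤? toℕ v) ≡ c v u (toℕ v ℕ.≤? toℕ u)
  symm u v with toℕ u ℕ.≤? toℕ v | toℕ v ℕ.≤? toℕ u
  ... | yes u≤v | yes v≤u with refl ← Fin.toℕ-injective (ℕ.≤-antisym u≤v v≤u) = refl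
  ... | yes _   | no  _   = refl
  ... | no  _   | yes _   = refl
  ... | no  u≰v | no  v≰u = contradiction (ℕ.≰⇒≥ u≰v) v≰u

symmetrize-cong : ∀ n {q} {f g : Fin (n * n) → Fin q} → f ≗ g → ∀ u v →
  color (symmetrize n f) u v ≡ color (symmetrize n g) u v
symmetrize-cong n f≗g u v with toℕ u ℕ.≤? toℕ v
... | yes _ = f≗g (combine u v)
... | no  _ = f≗g (combine v u)

pairs : ∀ {n} {C : Set} → EdgeColoring (complete n) C → Fin (n * n) → C
pairs {n} χ e = color χ (proj₁ (remQuot n e)) (proj₂ (remQuot {n} n e))

pairs-combine : ∀ {n} {C : Set} (χ : EdgeColoring (complete n) C) u v → pairs χ (combine u v) ≡ color χ u v
pairs-combine χ u v = cong (λ (x , y) → color χ x y) (Fin.remQuot-combine u v)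

symmetrize-pairs : ∀ {n q} (χ : EdgeColoring (complete n) (Fin q)) u v →
  color (symmetrize n (pairs χ)) u v ≡ color χ u v
symmetrize-pairs χ u v with toℕ u ℕ.≤? toℕ v
... | yes _ = pairs-combine χ u v
... | no  _ = trans (pairs-combine χ v u) (EdgeColoring.sym χ v u)

allColorings? : ∀ n q {Q : EdgeColoring (complete n) (Fin q) → Set} →
  (∀ {χ χ′} → (∀ u v → color χ u v ≡ color χ′ u v) → Q χ → Q χ′) →
  (∀ χ → Dec (Q χ)) → Dec (∀ χ → Q χ)
allColorings? n q resp Q? = map′
  (λ all χ → resp (symmetrize-pairs χ) (all (pairs χ)))
  (λ all g → all (symmetrize n g))
  (allFun? (n * n) (λ f≗g → resp (symmetrize-cong n f≗g)) (λ g → Q? (symmetrize n g)))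

Forces₂ : Graph → ℕ → Set
Forces₂ G n = (χ : EdgeColoring (complete n) (Fin 2)) → HasOrderableCopy G χ

ForcesCR : Graph → ℕ → Set
ForcesCR G n = ∀ q (χ : EdgeColoring (complete n) (Fin q)) → HasOrderableCopy G χ ⊎ HasRainbowCopy (complete 3) χ

forces₂? : ∀ G n → Dec (Forces₂ G n)
forces₂? G n = allColorings? n 2 (λ {χ} {χ′} eq → orderable-map χ χ′ id eq) (hasOrderableCopy? G)

-- An edge-coloring of K_n uses at most n * n colors, so that many suffice.
forcesCR-palette : ∀ G n → let N = suc n * suc n in
  (∀ (χ : EdgeColoring (complete (suc n)) (Fin N)) → HasOrderableCopy G χ ⊎ HasRainbowCopy (complete 3) χ) →
  ForcesCR G (suc n)
forcesCR-palette G n forces q χ = Sum.map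
  (orderable-map χ′ χ (pairs χ) (λ u v → pairs-h u v)) (rainbow-map χ′ χ h (λ _ _ → refl)) (forces χ′)
  where
  h : Fin q → Fin (suc n * suc n)
  h c with Fin.any? (λ e → pairs χ e Fin.≟ c)
  ... | yes (e , _) = e
  -- A default for colors that do not occur in `χ`; it exists because there is at least one vertex.
  ... | no  _       = zero
  χ′ : EdgeColoring (complete (suc n)) (Fin (suc n * suc n))
  χ′ = record { color = λ u v → h (color χ u v) ; sym = λ u v → cong h (EdgeColoring.sym χ u v) }
  pairs-h : ∀ u v → pairs χ (h (color χ u v)) ≡ color χ u v
  pairs-h u v with Fin.any? (λ e → pairs χ e Fin.≟ color χ u v)
  ... | yes (e , eq) = eq
  ... | no  none     = contradiction (combine u v , pairs-combine χ u v) none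

forcesCR? : ∀ G → Graph.Vertex G → ∀ n → Dec (ForcesCR G n)
-- The palette argument needs a default color, so zero vertices are treated apart: neither the
-- nonempty `G` nor a triangle fits there.
forcesCR? G x zero = no λ forces →
  [ (λ (f , _) → ¬Fin0 (Copy.embed f x)) , (λ (f , _) → ¬Fin0 (Copy.embed f zero)) ]′
    (forces 1 record { color = λ _ _ → zero ; sym = λ _ _ → refl })
  where
  ¬Fin0 : ¬ Fin 0
  ¬Fin0 ()
forcesCR? G x (suc n) = map′ (forcesCR-palette G n) (λ forces → forces _)
  (allColorings? (suc n) _ (λ {χ} {χ′} eq → Sum.map (orderable-map χ χ′ id eq) (rainbow-map χ χ′ id eq))
    (λ χ → hasOrderableCopy? G χ ⊎-dec hasRainbowTriangle? χ))

-- Existence and comparison of the minima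

minimum : ∀ {P : ℕ → Set} → (∀ n → Dec (P n)) → ∀ N → P N → ∃ λ n → IsMinimum P n × n ≤ N
minimum {P} P? N pN = search N N ℕ.≤-refl pN
  where
  search : ∀ k n → n ≤ k → P n → ∃ λ m → IsMinimum P m × m ≤ n
  search k n n≤k pn with ℕ.anyUpTo? P? n
  search k n n≤k pn | no none = n , (pn , λ m pm → ℕ.≮⇒≥ λ m<n → none (m , m<n , pm)) , ℕ.≤-refl
  search zero _ z≤n pn | yes (_ , () , _)
  search (suc k) n n≤k pn | yes (m , m<n , pm) =
    let l , min , l≤m = search k m (s≤s⁻¹ (ℕ.<-≤-trans m<n n≤k)) pm
    in l , min , ℕ.≤-trans l≤m (ℕ.<⇒≤ m<n)

-- Two colors cannot make a triangle rainbow, so `c` vertices also force an orderable copy in every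
-- 2-coloring; this bounds the search for `r`.
bounds : ∀ G → Graph.Vertex G → ∀ N → ForcesCR G N →
  ∃₂ λ r c → IsR′₂ G r × IsCR G (complete 3) c × r ≤ c × c ≤ N
bounds G x N forces =
  let c , min-c , c≤N = minimum (forcesCR? G x) N forces
      r , min-r , r≤c = minimum (forces₂? G) c
        (λ χ → [ id , (λ rainbow → contradiction rainbow (two-colors⇒no-rainbow χ)) ]′ (proj₁ min-c 2 χ))
  in r , c , min-r , min-c , r≤c , c≤N

forces : ∀ {s τ N} → Suffices (suc s) τ N → ForcesCR (completeBipartite (suc s) (suc τ)) N
forces {s} {τ} {N} cond q χ with hasRainbowTriangle? χ
... | yes rainbow = inj₂ rainbow
... | no  none    = inj₁ (FromWord.orderable-K⇒copy χ (orderable-K (suc N) s τ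
    (s≤s (ℕ.≤-reflexive (length-tabulate id))) (Unique.allFin⁺ N)
    (subst (Suffices (suc s) τ) (sym (length-tabulate id)) cond)))
  where open Main Fin._≟_ Fin._≟_ (EdgeColoring.color χ) (EdgeColoring.sym χ) (no-rainbow⇒gallai χ none)

-- Rounding in the explicit bounds

Suffices-2 : ∀ τ → Suffices 2 τ ((4 * suc τ) / 3 + 2)
-- For s = 2 and t = `suc τ` the condition reads n > 4t/3 + 1, and the floor exceeds 4t/3 - 1.
Suffices-2 τ = suffices (≤-by 5
  (ℕ.+-mono-≤ (ℕ.*-monoʳ-≤ 6 (ℕ.≤-reflexive (m≡m%n+[m/n]*n (4 * suc τ) 3)))
              (ℕ.*-monoʳ-≤ 6 (m%n<n (4 * suc τ) 3)))
  (eq τ ((4 * suc τ) % 3) ((4 * suc τ) / 3)))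
  where
  eq : ∀ τ r k → 6 * 4 * τ + 3 * 2 * 7 + 1 + (6 * (r + k * 3) + 6 * 3) + 5 ≡
       6 * 3 * (k + 2) + (6 * (4 * suc τ) + 6 * suc r)
  eq = solve-∀

open import Data.Integer.Base using (+_)

-- The ceiling is the negated floor of the negated fraction, so this is the lower estimate for
-- floors with signs reversed.
ceiling-upper : ∀ n d → n ℤ.≤ ceiling (mkℚᵘ n d) ℤ.* + suc d
ceiling-upper n d = begin
  n                                             ≡⟨ ℤ.neg-involutive n ⟨
  ℤ.- (ℤ.- n)                                   ≤⟨ ℤ.neg-mono-≤ (ℤ.[n/d]*d≤n (ℤ.- n) (+ suc d)) ⟩
  ℤ.- (((ℤ.- n) ℤ./ + suc d) ℤ.* + suc d)       ≡⟨ ℤ.neg-distribˡ-* ((ℤ.- n) ℤ./ + suc d) (+ suc d) ⟩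
  ceiling (mkℚᵘ n d) ℤ.* + suc d                ∎
  where open ℤ.≤-Reasoning

ceiling+1 : ∀ n a d → n ≡ + a →
  ∃ λ N → + N ≡ ceiling (mkℚᵘ n d) ℤ.+ + 1 × a + suc d ≤ N * suc d
ceiling+1 n a d refl with ceiling (mkℚᵘ n d) | ceiling-upper n d
... | + k | upper = k + 1 , refl , (begin
    a + suc d          ≤⟨ ℕ.+-monoˡ-≤ (suc d) (ℤ.drop‿+≤+ (subst (+ a ℤ.≤_) (sym (ℤ.pos-* k (suc d))) upper)) ⟩
    k * suc d + suc d  ≡⟨ eq k (suc d) ⟩
    (k + 1) * suc d    ∎)
  where
  open ℕ.≤-Reasoning
  eq : ∀ k d → k * d + d ≡ (k + 1) * d
  eq = solve-∀
... | -[1+ k ] | ()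

ratio : ℕ → ℕ → ℚᵘ
ratio s t = (+ (2 ^ s) ℚᵘ./ suc s) ℚᵘ.* (+ (t ∸ 1) ℚᵘ./ 1) ℚᵘ.+ (+ ((s ∸ 1) * (s + 6)) ℚᵘ./ 6)

-- The final `+ 1` reconciles the constants: (s-1)(s+6)/6 + 1 = s(s+5)/6.
Suffices-ceiling : ∀ z τ → ∃ λ N → + N ≡ ceiling (ratio (3 + z) (suc τ)) ℤ.+ + 1 × Suffices (3 + z) τ N
Suffices-ceiling z τ =
  -- The factors `suc (s * 1)` and `suc (5 + s * 1 * 6)` are the denominators that unnormalised
  -- rational arithmetic produces.
  let N , N≡ , le = ceiling+1 _ (2 ^ s * τ * 6 + (2 + z) * (s + 6) * suc (s * 1)) (5 + s * 1 * 6) numerator≡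
  in N , N≡ , suffices (≤-by 0 le (eq z (2 ^ s) τ N))
  where
  s = 3 + z
  numerator≡ : (+ (2 ^ s) ℤ.* + τ) ℤ.* + 6 ℤ.+ + ((2 + z) * (s + 6)) ℤ.* + suc (s * 1) ≡
    + (2 ^ s * τ * 6 + (2 + z) * (s + 6) * suc (s * 1))
  numerator≡ = sym (trans (ℤ.pos-+ (2 ^ s * τ * 6) _) (cong₂ ℤ._+_
    (trans (ℤ.pos-* (2 ^ s * τ) 6) (cong (ℤ._* + 6) (ℤ.pos-* (2 ^ s) τ)))
    (ℤ.pos-* ((2 + z) * (s + 6)) (suc (s * 1)))))
  eq : ∀ z x τ N → 6 * x * τ + (4 + z) * (3 + z) * (3 + z + 5) + 0 + N * (6 + (3 + z) * 1 * 6) + 0 ≡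
    6 * (4 + z) * N + (x * τ * 6 + (2 + z) * (3 + z + 6) * suc ((3 + z) * 1) + (6 + (3 + z) * 1 * 6))
  eq = solve-∀

theorem1p8 : (∀ (t : ℕ) → 2 ≤ t →
    ∃₂ λ (r c : ℕ) →
    IsR′₂ (completeBipartite 2 t) r
    × IsCR (completeBipartite 2 t) (complete 3) c
    × r ≤ c
    × c ≤ (4 * t) / 3 + 2)
    ×
    (∀ (s t : ℕ) → 3 ≤ s → s ≤ t →
    ∃₂ λ (r c : ℕ) →
    IsR′₂ (completeBipartite s t) r
    × IsCR (completeBipartite s t) (complete 3) c
    × r ≤ c
    × + c ℤ.≤ ceiling ((+ (2 ^ s) ℚᵘ./ suc s) ℚᵘ.* (+ (t ∸ 1) ℚᵘ./ 1)
    ℚᵘ.+ (+ ((s ∸ 1) * (s + 6)) ℚᵘ./ 6))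
    ℤ.+ + 1)
theorem1p8 =
  (λ { (suc τ) _ → bounds (completeBipartite 2 (suc τ)) zero _ (forces (Suffices-2 τ)) }) ,
  λ { (suc (suc (suc z))) (suc τ) _ _ →
        let N , N≡ , cond = Suffices-ceiling z τ
            r , c , isR′₂ , isCR , r≤c , c≤N = bounds (completeBipartite (3 + z) (suc τ)) zero N (forces cond)
        in r , c , isR′₂ , isCR , r≤c , ℤ.≤-trans (ℤ.+≤+ c≤N) (ℤ.≤-reflexive N≡)
    ; (suc (suc zero)) _ (s≤s (s≤s ())) _
    ; (suc zero) _ (s≤s ()) _ }
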